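{- Let $u\ge 2$ be an integer and let $q$ be a prime power such that $q\equiv 2^u+1 \pmod{2^{u+1}}$. Then for every positive integer $e$ there exists a skew Hadamard difference family with $2^{u-1}$ blocks in the additive group $(\mathbb{F}_{q^e},+)$ of the finite field of order $q^e$.
   Context: Let $(G,+)$ be a finite abelian group of order $v$. A difference family with parameters $(v,k,\lambda)$ in $G$ is a family $\{B_1,\dots,B_\ell\}$ of $k$-subsets of $G$ (the blocks) such that the list of differences $x-y$ with $x,y\in B_i$, $x\neq y$, $i=1,\dots,\ell$, contains every nonzero element of $G$ exactly $\lambda$ times. A block $B$ is skew if $B\cap(-B)=\emptyset$ and $B\cup(-B)=G\setminus\{0_G\}$. A difference family is skew Hadamard if all of its blocks are skew. -}

module Defs where

open import Level using (Level; _⊔_)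
open import Data.Nat using (ℕ; zero; suc; _+_)
open import Data.Bool using (Bool; true; false; if_then_else_; _∧_; not)
open import Data.Fin using (Fin; zero; suc)
import Data.Fin as Fin
open import Data.Fin.Subset using (Subset; _∈_; ∣_∣)
open import Data.Fin.Subset.Properties using (_∈?_)
open import Data.Product using (Σ; ∃; ∃-syntax; _×_; _,_)
open import Data.Sum using (_⊎_)
open import Relation.Nullary using (¬_; Dec; yes; no)
open import Relation.Nullary.Decidable using (isYes)
open import Relation.Binary.PropositionalEquality as ≡ using (_≡_)
open import Function.Bundles using (Inverse; _⇔_)
open import Algebra.Bundles using (AbelianGroup; CommutativeRing)

sumF : ∀ {n} → (Fin n → ℕ) → ℕ
sumF {zero}  f = 0
sumF {suc n} f = f zero + sumF (λ i → f (suc i))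

indicator : Bool → ℕ
indicator b = if b then 1 else 0

IsField : ∀ {c ℓ} → CommutativeRing c ℓ → Set (c ⊔ ℓ)
IsField R = (1# ≉ 0#) × (∀ x → x ≉ 0# → ∃[ y ] (x * y ≈ 1#))
  where open CommutativeRing R

Enumeration : ∀ {c ℓ} → AbelianGroup c ℓ → ℕ → Set (c ⊔ ℓ)
Enumeration G v = Inverse (≡.setoid (Fin v)) (AbelianGroup.setoid G)

-- Difference families in a finite abelian group G (written additively in
-- the paper; here _∙_ is the group operation, x ⁻¹ is -x, ε is 0_G).
-- Subsets of G are represented as subsets of the index set Fin v via the
-- enumeration.
module DF {c ℓ} (G : AbelianGroup c ℓ) {v : ℕ} (enum : Enumeration G v) where
  open AbelianGroup G
  open Inverse enum using (to; from; to-cong; from-cong) renaming (inverseˡ to to∘from)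

  _≈?_ : (x y : Carrier) → Dec (x ≈ y)
  x ≈? y with from x Fin.≟ from y
  ... | yes p = yes (trans (sym (to∘from ≡.refl)) (trans (to-cong p) (to∘from ≡.refl)))
  ... | no ¬p = no (λ x≈y → ¬p (from-cong x≈y))

  _∈G_ : Carrier → Subset v → Set
  x ∈G B = from x ∈ B

  diffCount : ∀ {n} → (Fin n → Subset v) → Carrier → ℕ
  diffCount B g = sumF λ i → sumF λ a → sumF λ b →
    indicator (isYes (a ∈? B i) ∧ isYes (b ∈? B i) ∧ not (isYes (a Fin.≟ b))
               ∧ isYes ((to a ∙ (to b) ⁻¹) ≈? g))

  IsDifferenceFamily : ∀ {n} → (Fin n → Subset v) → ℕ → ℕ → Set (c ⊔ ℓ)
  IsDifferenceFamily B k λ′ =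
    (∀ i → ∣ B i ∣ ≡ k) × (∀ g → g ≉ ε → diffCount B g ≡ λ′)

  IsSkew : Subset v → Set (c ⊔ ℓ)
  IsSkew B = (∀ x → ¬ (x ∈G B × (x ⁻¹) ∈G B))
           × (∀ x → (x ∈G B ⊎ (x ⁻¹) ∈G B) ⇔ (x ≉ ε))

  SkewHadamardDF : ℕ → Set (c ⊔ ℓ)
  SkewHadamardDF n = Σ (Fin n → Subset v) λ B →
    (∃[ k ] ∃[ λ′ ] IsDifferenceFamily B k λ′) × (∀ i → IsSkew (B i))

module Submission where

-- Replacing q by an odd power we may take e = 2^r. Then the field has 1 + 2^(u+r) m elements with m odd,
-- and q - 1 is 2^u times an odd number. Let s be a ±1-valued function on the nonzero elements with s(zx) = -s(x)
-- whenever z^m = -1, let τ satisfy τ^(2^(u-1)) = -1, and take as blocks B_i = {x : s(τ^i x) = 1}, i < 2^(u-1).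
-- The B_i form a difference family as soon as the sum B(g) of the autocorrelations of the functions s(τ^i x) is
-- constant for g ≠ 0.
--
-- Let K be the field of q elements, T the trace to K, and L the group of all x with x^(m 2^u) = 1, which contains K*.
-- B is L-invariant. By inversion of the hyperplane transform Φ(b) = Σ {B(g) : T(bg) = 0} it suffices that Φ is
-- constant for b ≠ 0. Now Φ(b) is the sum over i and k of (Σ {s(τ^i x) : T(bx) = k})².
-- The substitutions x ↦ x^(q^(2^j)) preserve T and change the sign of s at those x whose L-coset has order 2^(j+1),
-- so only x with bx ∈ L contribute. Hence the transform of s restricted to a coset b₀⁻¹L vanishes off b₀L, where it
-- agrees with the transform of s, and Φ(b₀) is determined by the Parseval identity for that restriction.

open import Defs
open import Algebra.Bundles using (CommutativeMonoid; CommutativeRing; RawRing)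
open import Algebra.Core using (Op₁; Op₂)
open import Algebra.Morphism.Structures using (IsRingMonomorphism)
import Algebra.Morphism.RingMonomorphism as RingMonomorphism
open import Algebra.Structures using (IsCommutativeRing)
open import Data.Bool using (Bool; if_then_else_; true; false; _∧_; not)
open import Data.Bool.Properties using (∧-zeroʳ)
open import Data.Empty using (⊥-elim)
open import Data.Fin as Fin using (Fin; zero; suc; toℕ; fromℕ; inject₁)
import Data.Fin.Properties as Fin
open import Data.Fin.Permutation using (permutation)
open import Data.Fin.Subset using (Subset; _∈_; ∣_∣)
open import Data.Fin.Subset.Properties using (_∈?_)
open import Data.Integer as ℤ using (ℤ; 0ℤ; 1ℤ)
import Data.Integer.Properties as ℤ
import Data.Integer.Tactic.RingSolver as ℤ-Solver
open import Data.Nat as ℕ using (ℕ; zero; suc; _≤_; _<_; s≤s; z≤n; _!)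
import Data.Nat.Properties as ℕ
import Data.Nat.Tactic.RingSolver as ℕ-Solver
open import Data.Nat.Combinatorics using (_C_; nCn≡1; k![n∸k]!∣n!; nCk≡n!/k![n-k]!)
open import Data.Nat.Divisibility using (_∣_; divides; ∣⇒≤; m∣m*n; ∣1⇒≡1)
open import Data.Nat.DivMod using (m/n*n≡m)
open import Data.Nat.Induction using (<-rec)
open import Data.Nat.Primality using (Prime; euclidsLemma; ¬prime[1])
open import Data.Product using (∃-syntax; _×_; _,_; proj₁; proj₂)
open import Data.Sum using (_⊎_; inj₁; inj₂)
open import Data.Vec using (Vec; []; _∷_; replicate; tabulate)
open import Data.Vec.Properties using (lookup∘tabulate; lookup⇒[]=; []=⇒lookup)
open import Function using (_∘_)
open import Function.Bundles using (Inverse; mk⇔)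
open import Level using (0ℓ)
open import Relation.Binary.Definitions using (Tri; tri<; tri≈; tri>)
open import Relation.Binary.PropositionalEquality
open import Relation.Nullary using (¬_; Dec; yes; no; does)
open import Relation.Nullary.Decidable using (isYes; isYes≗does; dec-true; dec-false)
import Algebra.Properties.AbelianGroup ℤ.+-0-abelianGroup as ℤ-group
open import Algebra.Properties.Semiring.Sum ℤ.+-*-semiring
  using (*-distribˡ-sum; *-distribʳ-sum; sum-init-last)
  renaming (sum to ∑; ∑-distrib-+ to ∑-+; ∑-comm to ∑-swap; sum-cong-≗ to ∑-cong)
open ≡-Reasoning

-- Arithmetic of the parameters

module Arithmetic where
  open import Data.Nat
  open import Data.Nat.Properties
  open import Data.Nat.Tactic.RingSolver using (solve-∀)

  Odd : ℕ → Set
  Odd n = ∃[ k ] n ≡ suc (2 * k)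

  odd-* : ∀ {m n} → Odd m → Odd n → Odd (m * n)
  odd-* (j , refl) (k , refl) = 2 * j * k + j + k , eq j k
    where
    eq : ∀ j k → suc (2 * j) * suc (2 * k) ≡ suc (2 * (2 * j * k + j + k))
    eq = solve-∀

  odd⊎even : ∀ n → ∃[ k ] ∃[ b ] b ≤ 1 × n ≡ b + 2 * k
  odd⊎even zero = 0 , 0 , z≤n , refl
  odd⊎even (suc n) with odd⊎even n
  ... | k , zero , _ , refl = k , 1 , s≤s z≤n , refl
  ... | k , suc zero , _ , refl = suc k , 0 , z≤n , cong suc (sym (+-suc k (k + 0)))
  ... | k , suc (suc _) , s≤s () , _

  2-adic : ∀ n → 1 ≤ n → ∃[ r ] ∃[ o ] Odd o × n ≡ o * 2 ^ r
  2-adic = <-rec _ step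
    where
    step : ∀ n → (∀ {k} → k < n → 1 ≤ k → ∃[ r ] ∃[ o ] Odd o × k ≡ o * 2 ^ r) →
           1 ≤ n → ∃[ r ] ∃[ o ] Odd o × n ≡ o * 2 ^ r
    step n rec 1≤n with odd⊎even n
    ... | k , suc zero , _ , eq = 0 , n , (k , eq) , sym (*-identityʳ n)
    ... | k , suc (suc _) , s≤s () , _
    step n rec () | zero , zero , _ , refl
    step n rec 1≤n | suc k , zero , _ , refl with rec {suc k} (m<m+n (suc k) z<s) (s≤s z≤n)
    ... | r , o , odd , eq = suc r , o , odd ,
      trans (cong (2 *_) eq) (trans (sym (*-assoc 2 o (2 ^ r)))
        (trans (cong (_* 2 ^ r) (*-comm 2 o)) (*-assoc o 2 (2 ^ r))))

  -- The shape q = 1 + 2^u * odd survives odd powers, because q² ≡ 1 (mod 2^(u+1)).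
  odd-power : ∀ q d m → Odd m → q ≡ suc (2 * d * m) →
              ∀ o → Odd o → ∃[ m′ ] Odd m′ × q ^ o ≡ suc (2 * d * m′)
  odd-power q d _ (a , refl) eq _ (k , refl) with square-power k
    where
    alg : ∀ d m j → suc (2 * d * m) * (suc (2 * d * m) * suc (2 * (2 * d) * j))
        ≡ suc (2 * (2 * d) * (j * suc (2 * d * m) * suc (2 * d * m) + m + d * m * m))
    alg = solve-∀
    square-power : ∀ k → ∃[ j ] q ^ (2 * k) ≡ suc (2 * (2 * d) * j)
    square-power zero = 0 , sym (cong suc (*-zeroʳ (2 * (2 * d))))
    square-power (suc k) with square-power k
    ... | j , ih = _ , trans (cong (q ^_) (*-suc 2 k)) (trans (cong (λ z → q * (q * z)) ih)
            (trans (cong (λ z → z * (z * suc (2 * (2 * d) * j))) eq) (alg d (suc (2 * a)) j)))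
  ... | j , q²ᵏ = _ , (a + j + 2 * d * suc (2 * a) * j , refl) ,
    trans (cong₂ _*_ eq q²ᵏ) (alg d a j)
    where
    alg : ∀ d a j → suc (2 * d * suc (2 * a)) * suc (2 * (2 * d) * j)
        ≡ suc (2 * d * suc (2 * (a + j + 2 * d * suc (2 * a) * j)))
    alg = solve-∀

  -- Squaring 1 + x gives 1 + 2x(1 + x/2). As 4 divides x, the new factor 1 + x/2 is odd, so one
  -- more factor 2 is split off and `o` stays odd.
  power-of-two-power : ∀ q a → q ≡ suc (4 * a) →
                       ∀ i → ∃[ o ] Odd o × q ^ (2 ^ i) ≡ suc (2 ^ i * o * (4 * a))
  power-of-two-power q a eq zero = 1 , (0 , refl) , trans (^-identityʳ q) (trans eq (cong suc (sym (*-identityˡ (4 * a)))))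
  power-of-two-power q a eq (suc i) with power-of-two-power q a eq i
  ... | _ , (k , refl) , ih = _ , odd-* (k , refl) (2 ^ i * suc (2 * k) * a , refl) ,
    trans (cong (q ^_) (*-comm 2 (2 ^ i))) (trans (sym (^-*-assoc q (2 ^ i) 2))
      (trans (cong (_^ 2) ih) (alg (2 ^ i) (suc (2 * k)) a)))
    where
    alg : ∀ w o a → suc (w * o * (4 * a)) * (suc (w * o * (4 * a)) * 1) ≡ suc (2 * w * (o * suc (2 * (w * o * a))) * (4 * a))
    alg = solve-∀

  -- `parameters` takes for `q` the power of the given prime power by the odd part of e, so the
  -- field has degree 2^r over K. The field `powers` is needed at i = r for the shape of v - 1 and
  -- at i < r for the Frobenius substitutions.
  record Parameters (u v p : ℕ) : Set where
    field
      r q n m′ : ℕ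
      m′-odd   : Odd m′
      q≡pⁿ     : q ≡ p ^ n
      q≡       : q ≡ suc (2 ^ u * m′)
      v≡       : v ≡ q ^ (2 ^ r)
      powers   : ∀ i → ∃[ o ] Odd o × q ^ (2 ^ i) ≡ suc (2 ^ i * o * (2 ^ u * m′))

  parameters : ∀ u p n t e → 1 ≤ e → p ^ n ≡ 2 ^ (2 + u) + 1 + t * 2 ^ suc (2 + u) →
               Parameters (2 + u) ((p ^ n) ^ e) p
  parameters u p n t e 1≤e eq with 2-adic e 1≤e
  ... | r , o , odd , refl with odd-power (p ^ n) (2 * 2 ^ u) (suc (2 * t)) (t , refl) (trans eq (alg (2 ^ u) t)) o odd
    where
    alg : ∀ c t → 2 * (2 * c) + 1 + t * (2 * (2 * (2 * c))) ≡ suc (2 * (2 * c) * suc (2 * t))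
    alg = solve-∀
  ... | m′ , m′-odd , eq′ = record
    { r = r ; q = (p ^ n) ^ o ; n = n * o ; m′ = m′ ; m′-odd = m′-odd
    ; q≡pⁿ = ^-*-assoc p n o
    ; q≡ = eq′
    ; v≡ = sym (^-*-assoc (p ^ n) o (2 ^ r))
    ; powers = λ i → let o′ , odd′ , eq″ = power-of-two-power _ (2 ^ u * m′) (trans eq′ (cong suc (alg (2 ^ u) m′))) i
                     in o′ , odd′ , trans eq″ (cong (λ z → suc (2 ^ i * o′ * z)) (sym (alg (2 ^ u) m′)))
    }
    where
    alg : ∀ c m → 2 * (2 * c) * m ≡ 4 * (c * m)
    alg = solve-∀

open Arithmetic

-- Sums over finite sets

module _ {v : ℕ} where

  δ : Fin v → Fin v → ℤ
  δ x y = if does (x Fin.≟ y) then 1ℤ else 0ℤ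

  δ-yes : ∀ {x y} → x ≡ y → δ x y ≡ 1ℤ
  δ-yes {x} {y} x≡y = cong (λ b → if b then 1ℤ else 0ℤ) (dec-true (x Fin.≟ y) x≡y)

  δ-no : ∀ {x y} → x ≢ y → δ x y ≡ 0ℤ
  δ-no {x} {y} x≢y = cong (λ b → if b then 1ℤ else 0ℤ) (dec-false (x Fin.≟ y) x≢y)

  δ-⇔ : ∀ {x y z w} → (x ≡ y → z ≡ w) → (z ≡ w → x ≡ y) → δ x y ≡ δ z w
  δ-⇔ {x} {y} to from with x Fin.≟ y
  ... | yes x≡y = sym (δ-yes (to x≡y))
  ... | no x≢y = sym (δ-no (x≢y ∘ from))

  δ-nonneg : ∀ x y → 0ℤ ℤ.≤ δ x y
  δ-nonneg x y with does (x Fin.≟ y)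
  ... | true = ℤ.+≤+ ℕ.z≤n
  ... | false = ℤ.+≤+ ℕ.z≤n

∑-zero : ∀ n → ∑ {n} (λ _ → 0ℤ) ≡ 0ℤ
∑-zero zero = refl
∑-zero (suc n) = trans (ℤ.+-identityˡ _) (∑-zero n)

∑-≡0 : ∀ {n} {f : Fin n → ℤ} → (∀ x → f x ≡ 0ℤ) → ∑ f ≡ 0ℤ
∑-≡0 {n} f≡0 = trans (∑-cong f≡0) (∑-zero n)

∑-neg : ∀ {n} (f : Fin n → ℤ) → ∑ (λ x → ℤ.- f x) ≡ ℤ.- ∑ f
∑-neg f = trans (∑-cong (λ x → sym (ℤ.-1*i≡-i (f x)))) (trans (sym (*-distribˡ-sum (ℤ.- 1ℤ) f)) (ℤ.-1*i≡-i (∑ f)))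

∑-δ : ∀ {n} (a : Fin n) (f : Fin n → ℤ) → ∑ (λ k → δ a k ℤ.* f k) ≡ f a
∑-δ zero f = trans (cong₂ ℤ._+_ (ℤ.*-identityˡ (f zero)) (∑-≡0 (λ x → ℤ.*-zeroˡ (f (suc x))))) (ℤ.+-identityʳ (f zero))
∑-δ (suc a) f = trans (cong₂ ℤ._+_ (ℤ.*-zeroˡ (f zero)) (∑-δ a (f ∘ suc))) (ℤ.+-identityˡ (f (suc a)))

∑-nonneg : ∀ {n} (f : Fin n → ℤ) → (∀ x → 0ℤ ℤ.≤ f x) → 0ℤ ℤ.≤ ∑ f
∑-nonneg {zero} f f≥0 = ℤ.≤-refl
∑-nonneg {suc n} f f≥0 = ℤ.+-mono-≤ (f≥0 zero) (∑-nonneg (f ∘ suc) (f≥0 ∘ suc))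

∑-positive : ∀ {n} (f : Fin n → ℤ) → (∀ x → 0ℤ ℤ.≤ f x) → ∀ a → 0ℤ ℤ.< f a → 0ℤ ℤ.< ∑ f
∑-positive f f≥0 zero f₀>0 = ℤ.+-mono-<-≤ f₀>0 (∑-nonneg (f ∘ suc) (f≥0 ∘ suc))
∑-positive f f≥0 (suc a) fₐ>0 = ℤ.+-mono-≤-< (f≥0 zero) (∑-positive (f ∘ suc) (f≥0 ∘ suc) a fₐ>0)

-- After adding `a 0`, both sides are the sum of a 0, ..., a n: on the left directly, on the right
-- because `a 0` may be replaced by `a n`.
∑-cyclic : ∀ n (a : ℕ → ℤ) → a n ≡ a 0 → ∑ {n} (λ i → a (suc (toℕ i))) ≡ ∑ {n} (λ i → a (toℕ i))
∑-cyclic n a aₙ≡a₀ = ℤ-group.∙-cancelˡ (a 0) _ _ (begin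
  ∑ {suc n} (λ i → a (toℕ i))                            ≡⟨ sum-init-last {n} (λ i → a (toℕ i)) ⟩
  ∑ {n} (λ i → a (toℕ (inject₁ i))) ℤ.+ a (toℕ (fromℕ n)) ≡⟨ cong₂ ℤ._+_ (∑-cong {n} (λ i → cong a (Fin.toℕ-inject₁ i))) (trans (cong a (Fin.toℕ-fromℕ n)) aₙ≡a₀) ⟩
  ∑ {n} (λ i → a (toℕ i)) ℤ.+ a 0                        ≡⟨ ℤ.+-comm _ (a 0) ⟩
  a 0 ℤ.+ ∑ {n} (λ i → a (toℕ i))                        ∎)

i≡-i⇒i≡0 : ∀ {i} → i ≡ ℤ.- i → i ≡ 0ℤ
i≡-i⇒i≡0 {ℤ.+ zero} _ = refl
i≡-i⇒i≡0 {ℤ.+ suc n} ()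
i≡-i⇒i≡0 {ℤ.-[1+ n ]} ()

cancelˡ-pos : ∀ {a i j} → 0ℤ ℤ.< a → a ℤ.* i ≡ a ℤ.* j → i ≡ j
cancelˡ-pos {a} {i} {j} a>0 = ℤ.*-cancelˡ-≡ a i j {{ℤ.>-nonZero a>0}}

ind : Bool → ℤ
ind b = if b then 1ℤ else 0ℤ

ind-∧ : ∀ a b → ind (a ∧ b) ≡ ind a ℤ.* ind b
ind-∧ true b = sym (ℤ.*-identityˡ (ind b))
ind-∧ false b = refl

does-true : ∀ {P : Set} (P? : Dec P) → does P? ≡ true → P
does-true (yes p) _ = p

+indicator : ∀ b → ℤ.+ indicator b ≡ ind b
+indicator true = refl
+indicator false = refl

+sumF : ∀ {n} (f : Fin n → ℕ) → ℤ.+ sumF f ≡ ∑ (λ i → ℤ.+ f i)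
+sumF {zero} f = refl
+sumF {suc n} f = trans (ℤ.pos-+ (f zero) _) (cong (λ w → ℤ.+ f zero ℤ.+ w) (+sumF (f ∘ suc)))

+∣tabulate∣ : ∀ {n} (f : Fin n → Bool) → ℤ.+ ∣ tabulate f ∣ ≡ ∑ (λ i → ind (f i))
+∣tabulate∣ {zero} f = refl
+∣tabulate∣ {suc n} f with f zero
... | true = cong (λ w → 1ℤ ℤ.+ w) (+∣tabulate∣ (f ∘ suc))
... | false = trans (+∣tabulate∣ (f ∘ suc)) (sym (ℤ.+-identityˡ _))

∈-tabulate⁺ : ∀ {n} (f : Fin n → Bool) {a} → f a ≡ true → a ∈ tabulate f
∈-tabulate⁺ f {a} eq = lookup⇒[]= a (tabulate f) (trans (lookup∘tabulate f a) eq)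

∈-tabulate⁻ : ∀ {n} (f : Fin n → Bool) {a} → a ∈ tabulate f → f a ≡ true
∈-tabulate⁻ f {a} a∈ = trans (sym (lookup∘tabulate f a)) ([]=⇒lookup a∈)

isYes-∈?-tabulate : ∀ {n} (f : Fin n → Bool) a → isYes (a ∈? tabulate f) ≡ f a
isYes-∈?-tabulate f a = trans (isYes≗does (a ∈? tabulate f)) (case (f a) refl)
  where
  case : ∀ b → f a ≡ b → does (a ∈? tabulate f) ≡ b
  case true eq = dec-true (a ∈? tabulate f) (∈-tabulate⁺ f eq)
  case false eq = dec-false (a ∈? tabulate f) (λ a∈ → false≢true (trans (sym eq) (∈-tabulate⁻ f a∈)))
    where
    false≢true : false ≢ true
    false≢true ()

sumF-cong : ∀ {n} {f g : Fin n → ℕ} → (∀ i → f i ≡ g i) → sumF f ≡ sumF g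
sumF-cong {zero} f≡g = refl
sumF-cong {suc n} f≡g = cong₂ ℕ._+_ (f≡g zero) (sumF-cong (f≡g ∘ suc))

module _ {c ℓ} (M : CommutativeMonoid c ℓ) where
  open CommutativeMonoid M using (_≈_; ε; identityˡ; identityʳ; ∙-congˡ)
    renaming (Carrier to A; trans to ≈-trans)
  open import Algebra.Properties.CommutativeMonoid.Sum M

  sum-at : ∀ {n} (a : Fin n) (f : Fin n → A) → sum (λ k → if does (a Fin.≟ k) then f k else ε) ≈ f a
  sum-at {suc n} zero f = ≈-trans (∙-congˡ (sum-replicate-zero n)) (identityʳ _)
  sum-at (suc a) f = ≈-trans (identityˡ _) (sum-at a (f ∘ suc))

  sum-reindex : ∀ {n} (f : Fin n → A) (π ρ : Fin n → Fin n) → (∀ x → π (ρ x) ≡ x) → (∀ x → ρ (π x) ≡ x) →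
                sum f ≈ sum (f ∘ π)
  sum-reindex f π ρ πρ ρπ = sum-permute f (permutation π ρ πρ ρπ)

-- Finite fields

prime∤! : ∀ {p} → Prime p → ∀ k → k < p → ¬ p ∣ k !
prime∤! pr zero _ p∣1 with ∣1⇒≡1 p∣1
... | refl = ⊥-elim (¬prime[1] pr)
prime∤! pr (suc k) k<p p∣ with euclidsLemma (suc k) (k !) pr p∣
... | inj₁ p∣1+k = ℕ.<⇒≱ k<p (∣⇒≤ p∣1+k)
... | inj₂ p∣k! = prime∤! pr k (ℕ.<-trans (ℕ.n<1+n k) k<p) p∣k!

-- The prime divides p! = C(p,k) k! (p-k)!, but neither k! nor (p-k)!.
prime∣C : ∀ {p} → Prime p → ∀ k → 1 ≤ k → k < p → p ∣ p C k
prime∣C {p@(suc p′)} pr k 1≤k k<p with euclidsLemma (p C k) (k ! ℕ.* (p ℕ.∸ k) !) pr p∣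
  where
  k≤p = ℕ.<⇒≤ k<p
  instance nz = k ℕ.!* (p ℕ.∸ k) !≢0
  C*≡p! : (p C k) ℕ.* (k ! ℕ.* (p ℕ.∸ k) !) ≡ p !
  C*≡p! = trans (cong (ℕ._* (k ! ℕ.* (p ℕ.∸ k) !)) (nCk≡n!/k![n-k]! {p} {k} k≤p)) (m/n*n≡m (k![n∸k]!∣n! k≤p))
  p∣ : p ∣ (p C k) ℕ.* (k ! ℕ.* (p ℕ.∸ k) !)
  p∣ = subst (p ∣_) (sym C*≡p!) (m∣m*n (p′ !))
... | inj₁ p∣C = p∣C
... | inj₂ p∣kk with euclidsLemma (k !) _ pr p∣kk
...   | inj₁ p∣k! = ⊥-elim (prime∤! pr k k<p p∣k!)
...   | inj₂ p∣k! = ⊥-elim (prime∤! pr (p ℕ.∸ k) (ℕ.∸-monoʳ-< 1≤k (ℕ.<⇒≤ k<p)) p∣k!)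

-- The field is carried by `Fin v`: equality is propositional and decidable, sums over the field are
-- sums over `Fin v`, and the order of the indices later serves to choose signs.
module FiniteField {v : ℕ} {add mul : Op₂ (Fin v)} {neg : Op₁ (Fin v)} {zero# one# : Fin v}
  (isCommutativeRing : IsCommutativeRing _≡_ add mul neg zero# one#)
  (1≢0 : one# ≢ zero#) (invertible : ∀ x → x ≢ zero# → ∃[ y ] mul x y ≡ one#) where

  R : CommutativeRing 0ℓ 0ℓ
  R = record { isCommutativeRing = isCommutativeRing }

  open CommutativeRing R public
    hiding (refl; sym; trans; isCommutativeRing; Carrier; setoid; reflexive; isEquivalence; _≈_; _≉_; zero)
  open import Algebra.Properties.Ring ring public
    using (-‿distribʳ-*; -‿involutive; -1*x≈-x; -0#≈0#; x∙y⁻¹≈ε⇒x≈y; x[y-z]≈xy-xz; +-cancelˡ)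
    renaming (+-inverseʳ-unique to negative-unique)
  open import Algebra.Properties.CommutativeSemigroup +-commutativeSemigroup public
    using () renaming (interchange to +-interchange)
  open import Algebra.Properties.CommutativeSemiring.Exp commutativeSemiring public
    using (_^_; ^-homo-*; ^-assocʳ; ^-distrib-*)
  open import Algebra.Properties.Semiring.Mult semiring public
    using (×1-homo-*; ×-assoc-*) renaming (_×_ to _·_)
  open import Algebra.Properties.CommutativeSemigroup *-commutativeSemigroup public
    using (x∙yz≈y∙xz)
  open import Algebra.Properties.CommutativeMonoid.Sum +-commutativeMonoid using ()
    renaming (sum to ∑ᶠ; ∑-distrib-+ to ∑ᶠ-+; sum-replicate to ∑ᶠ-replicate; sum-cong-≗ to ∑ᶠ-cong; sum-init-last to ∑ᶠ-init-last; sum-replicate-zero to ∑ᶠ-zero)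
  open import Algebra.Properties.CommutativeMonoid.Sum *-commutativeMonoid using ()
    renaming (sum to ∏; ∑-distrib-+ to ∏-*; sum-replicate to ∏-replicate; sum-cong-≗ to ∏-cong)
  import Algebra.Properties.CommutativeSemiring.Binomial commutativeSemiring as Binomial

  X : Set
  X = Fin v

  *-cancelˡ-≢0 : ∀ {a x y} → a ≢ 0# → a * x ≡ a * y → x ≡ y
  *-cancelˡ-≢0 {a} {x} {y} a≢0 eq with invertible a a≢0
  ... | b , ab≡1 = trans (sym (undo x)) (trans (cong (b *_) eq) (undo y))
    where
    undo : ∀ z → b * (a * z) ≡ z
    undo z = trans (sym (*-assoc b a z)) (trans (cong (_* z) (trans (*-comm b a) ab≡1)) (*-identityˡ z))

  xy≡0⇒y≡0 : ∀ {x y} → x ≢ 0# → x * y ≡ 0# → y ≡ 0#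
  xy≡0⇒y≡0 {x} x≢0 xy≡0 = *-cancelˡ-≢0 x≢0 (trans xy≡0 (sym (zeroʳ x)))

  *-≢0 : ∀ {x y} → x ≢ 0# → y ≢ 0# → x * y ≢ 0#
  *-≢0 x≢0 y≢0 = y≢0 ∘ xy≡0⇒y≡0 x≢0

  ^-≢0 : ∀ {x} n → x ≢ 0# → x ^ n ≢ 0#
  ^-≢0 zero x≢0 = 1≢0
  ^-≢0 (suc n) x≢0 = *-≢0 x≢0 (^-≢0 n x≢0)

  1^ : ∀ n → 1# ^ n ≡ 1#
  1^ zero = refl
  1^ (suc n) = trans (*-identityˡ _) (1^ n)

  0^ : ∀ n → 1 ≤ n → 0# ^ n ≡ 0#
  0^ (suc n) _ = zeroˡ _

  x-y+y≡x : ∀ x y → x - y + y ≡ x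
  x-y+y≡x x y = trans (+-assoc x (- y) y) (trans (cong (x +_) (-‿inverseˡ y)) (+-identityʳ x))

  x+y-y≡x : ∀ x y → x + y - y ≡ x
  x+y-y≡x x y = trans (+-assoc x y (- y)) (trans (cong (x +_) (-‿inverseʳ y)) (+-identityʳ x))

  y+[x-y]≡x : ∀ x y → y + (x - y) ≡ x
  y+[x-y]≡x x y = trans (+-comm y _) (x-y+y≡x x y)

  module _ {c ℓ} (M : CommutativeMonoid c ℓ) where
    open CommutativeMonoid M using () renaming (Carrier to A; _≈_ to _≋_)
    open import Algebra.Properties.CommutativeMonoid.Sum M using (sum)

    sum-scale : (f : X → A) {a : X} → a ≢ 0# → sum f ≋ sum (λ x → f (a * x))
    sum-scale f {a} a≢0 with invertible a a≢0
    ... | b , ab≡1 = sum-reindex M f (a *_) (b *_) (undo ab≡1) (undo (trans (*-comm b a) ab≡1))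
      where
      undo : ∀ {c d} → c * d ≡ 1# → ∀ x → c * (d * x) ≡ x
      undo cd≡1 x = trans (sym (*-assoc _ _ x)) (trans (cong (_* x) cd≡1) (*-identityˡ x))

    sum-translate : (f : X → A) (a : X) → sum f ≋ sum (λ x → f (x + a))
    sum-translate f a = sum-reindex M f (_+ a) (_- a) (λ x → x-y+y≡x x a) (λ x → x+y-y≡x x a)

  ∏-≢0 : ∀ {n} (f : Fin n → X) → (∀ i → f i ≢ 0#) → ∏ f ≢ 0#
  ∏-≢0 {zero} f f≢0 = 1≢0
  ∏-≢0 {suc n} f f≢0 = *-≢0 (f≢0 zero) (∏-≢0 (f ∘ suc) (f≢0 ∘ suc))

  -- Multiplication by a permutes the nonzero elements, so their product absorbs the factors a.
  x^v≡x : ∀ a → a ^ v ≡ a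
  x^v≡x a with a Fin.≟ 0#
  ... | yes refl = 0^ v (ℕ.≤-trans (s≤s z≤n) (Fin.toℕ<n 0#))
  ... | no a≢0 = begin
    a ^ v                    ≡⟨ ∏-replicate v ⟨
    ∏ {v} (λ _ → a)          ≡⟨ ∏-cong h*h′ ⟨
    ∏ (λ x → h x * h′ x)     ≡⟨ ∏-* h h′ ⟩
    ∏ h * ∏ h′               ≡⟨ cong₂ _*_ ∏h≡1 (sum-at *-commutativeMonoid 0# (λ _ → a)) ⟩
    1# * a                   ≡⟨ *-identityˡ a ⟩
    a                        ∎
    where
    g h h′ : X → X
    g x = if does (0# Fin.≟ x) then 1# else x
    h x = if does (0# Fin.≟ x) then 1# else a
    h′ x = if does (0# Fin.≟ x) then a else 1#
    h*h′ : ∀ x → h x * h′ x ≡ a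
    h*h′ x with does (0# Fin.≟ x)
    ... | true = *-identityˡ a
    ... | false = *-identityʳ a
    g≢0 : ∀ x → g x ≢ 0#
    g≢0 x with 0# Fin.≟ x
    ... | yes _ = 1≢0
    ... | no 0≢x = 0≢x ∘ sym
    g[ax] : ∀ x → g (a * x) ≡ g x * h x
    g[ax] x with 0# Fin.≟ x | 0# Fin.≟ a * x
    ... | yes _ | yes _ = sym (*-identityˡ 1#)
    ... | no _ | no _ = *-comm a x
    ... | yes refl | no 0≢ = ⊥-elim (0≢ (sym (zeroʳ a)))
    ... | no 0≢x | yes 0≡ = ⊥-elim (0≢x (sym (xy≡0⇒y≡0 a≢0 (sym 0≡))))
    ∏h≡1 : ∏ h ≡ 1#
    ∏h≡1 = *-cancelˡ-≢0 (∏-≢0 g g≢0) (begin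
      ∏ g * ∏ h              ≡⟨ ∏-* g h ⟨
      ∏ (λ x → g x * h x)    ≡⟨ ∏-cong g[ax] ⟨
      ∏ (λ x → g (a * x))    ≡⟨ sum-scale *-commutativeMonoid g a≢0 ⟨
      ∏ g                    ≡⟨ *-identityʳ _ ⟨
      ∏ g * 1#               ∎)

  -- Characteristic and the Frobenius map

  v·1≡0 : v · 1# ≡ 0#
  v·1≡0 = +-cancelˡ (∑ᶠ {v} (λ x → x)) _ _ (begin
    ∑ᶠ (λ x → x) + v · 1#              ≡⟨ cong (∑ᶠ {v} (λ x → x) +_) (∑ᶠ-replicate v) ⟨
    ∑ᶠ (λ x → x) + ∑ᶠ {v} (λ _ → 1#)    ≡⟨ ∑ᶠ-+ (λ x → x) (λ _ → 1#) ⟨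
    ∑ᶠ (λ x → x + 1#)                  ≡⟨ sum-translate +-commutativeMonoid (λ x → x) 1# ⟨
    ∑ᶠ (λ x → x)                       ≡⟨ +-identityʳ _ ⟨
    ∑ᶠ (λ x → x) + 0#                  ∎)

  -- The n-th power of p · 1 is v · 1. This vanishes, because adding 1 to every element permutes the
  -- field and so preserves the sum of all elements.
  characteristic : ∀ {p} n → v ≡ p ℕ.^ n → p · 1# ≡ 0#
  characteristic {p} n v≡ with (p · 1#) Fin.≟ 0#
  ... | yes eq = eq
  ... | no p≢0 = ⊥-elim (^-≢0 n p≢0 (trans (sym (power n)) (trans (cong (_· 1#) (sym v≡)) v·1≡0)))
    where
    power : ∀ n → (p ℕ.^ n) · 1# ≡ (p · 1#) ^ n
    power zero = +-identityʳ 1#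
    power (suc n) = trans (×1-homo-* p (p ℕ.^ n)) (cong (p · 1# *_) (power n))

  freshman : ∀ {p} → Prime p → p · 1# ≡ 0# → ∀ x y → (x + y) ^ p ≡ x ^ p + y ^ p
  freshman {p@(suc p′)} pr p≡0 x y = begin
    (x + y) ^ p                                          ≡⟨ Binomial.theorem p x y ⟩
    t zero + ∑ᶠ (λ i → t (suc i))                         ≡⟨ cong (t zero +_) (∑ᶠ-init-last (λ i → t (suc i))) ⟩
    t zero + (∑ᶠ (λ i → t (suc (inject₁ i))) + t (suc (fromℕ p′)))
      ≡⟨ cong₂ (λ a b → a + (b + t (suc (fromℕ p′)))) first (trans (∑ᶠ-cong middle) (∑ᶠ-zero p′)) ⟩
    y ^ p + (0# + t (suc (fromℕ p′)))                    ≡⟨ cong (y ^ p +_) (trans (+-identityˡ _) last) ⟩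
    y ^ p + x ^ p                                        ≡⟨ +-comm _ _ ⟩
    x ^ p + y ^ p                                        ∎
    where
    t : Fin (suc p) → X
    t = Binomial.binomialTerm x y p
    multiple≡0 : ∀ {n} z → p ∣ n → n · z ≡ 0#
    multiple≡0 z (divides k refl) = begin
      (k ℕ.* p) · z           ≡⟨ cong ((k ℕ.* p) ·_) (*-identityˡ z) ⟨
      (k ℕ.* p) · (1# * z)    ≡⟨ ×-assoc-* (k ℕ.* p) 1# z ⟨
      ((k ℕ.* p) · 1#) * z    ≡⟨ cong (_* z) (trans (×1-homo-* k p) (trans (cong (k · 1# *_) p≡0) (zeroʳ _))) ⟩
      0# * z                  ≡⟨ zeroˡ z ⟩
      0#                      ∎
    first : t zero ≡ y ^ p
    first = trans (+-identityʳ _) (*-identityˡ _)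
    middle : ∀ i → t (suc (inject₁ i)) ≡ 0#
    middle i = multiple≡0 _ (prime∣C pr _ (s≤s z≤n) (s≤s (subst (_< p′) (sym (Fin.toℕ-inject₁ i)) (Fin.toℕ<n i))))
    last : t (suc (fromℕ p′)) ≡ x ^ p
    last = trans (cong (λ k → (p C suc k) · (x ^ suc k * y ^ (p′ ℕ.∸ k))) (Fin.toℕ-fromℕ p′))
      (trans (cong₂ (λ c e → c · (x ^ p * y ^ e)) (nCn≡1 p) (ℕ.n∸n≡0 p′))
        (trans (+-identityʳ _) (*-identityʳ _)))

  frobenius-+ : ∀ {p} → Prime p → p · 1# ≡ 0# → ∀ n x y → (x + y) ^ (p ℕ.^ n) ≡ x ^ (p ℕ.^ n) + y ^ (p ℕ.^ n)
  frobenius-+ pr p≡0 zero x y = trans (*-identityʳ _) (sym (cong₂ _+_ (*-identityʳ x) (*-identityʳ y)))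
  frobenius-+ {p} pr p≡0 (suc n) x y = begin
    (x + y) ^ (p ℕ.* p ℕ.^ n)                          ≡⟨ ^-assocʳ (x + y) p _ ⟨
    ((x + y) ^ p) ^ (p ℕ.^ n)                          ≡⟨ cong (_^ (p ℕ.^ n)) (freshman pr p≡0 x y) ⟩
    (x ^ p + y ^ p) ^ (p ℕ.^ n)                        ≡⟨ frobenius-+ pr p≡0 n _ _ ⟩
    (x ^ p) ^ (p ℕ.^ n) + (y ^ p) ^ (p ℕ.^ n)          ≡⟨ cong₂ _+_ (^-assocʳ x p _) (^-assocʳ y p _) ⟩
    x ^ (p ℕ.* p ℕ.^ n) + y ^ (p ℕ.* p ℕ.^ n)          ∎

  -- Roots of polynomials

  monic : ∀ {n} → Vec X n → X → X
  monic [] x = 1#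
  monic (c ∷ cs) x = c + x * monic cs x

  -- Synthetic division by x - r. Coefficient vectors start with the constant term and omit the
  -- leading 1; the coefficients of the quotient are the Horner values at `r`.
  quotient : ∀ {n} → X → Vec X (suc n) → Vec X n
  quotient r (c ∷ []) = []
  quotient r (c ∷ cs@(_ ∷ _)) = monic cs r ∷ quotient r cs

  monic-factor : ∀ {n} r (cs : Vec X (suc n)) x → monic cs x ≡ monic cs r + (x - r) * monic (quotient r cs) x
  monic-factor r (c ∷ cs) x = trans (cong (c +_) (horner cs)) (sym (+-assoc _ _ _))
    where
    horner : ∀ {n} (cs : Vec X n) → x * monic cs x ≡ r * monic cs r + (x - r) * monic (quotient r (c ∷ cs)) x
    horner [] = trans (*-identityʳ x) (sym (trans (cong₂ _+_ (*-identityʳ r) (*-identityʳ (x - r))) (y+[x-y]≡x x r)))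
    horner cs@(_ ∷ _) = begin
      x * monic cs x                                        ≡⟨ cong (x *_) (monic-factor r cs x) ⟩
      x * (G + (x - r) * Q)                                 ≡⟨ distribˡ x G _ ⟩
      x * G + x * ((x - r) * Q)                             ≡⟨ cong₂ (λ a b → a * G + b) (sym (y+[x-y]≡x x r)) (x∙yz≈y∙xz x (x - r) Q) ⟩
      (r + (x - r)) * G + (x - r) * (x * Q)                 ≡⟨ cong (_+ (x - r) * (x * Q)) (distribʳ G r (x - r)) ⟩
      r * G + (x - r) * G + (x - r) * (x * Q)               ≡⟨ +-assoc _ _ _ ⟩
      r * G + ((x - r) * G + (x - r) * (x * Q))             ≡⟨ cong (r * G +_) (distribˡ (x - r) G (x * Q)) ⟨
      r * G + (x - r) * (G + x * Q)                         ∎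
      where
      G = monic cs r
      Q = monic (quotient r cs) x

  -- Dividing out the first root leaves a polynomial of smaller degree that still vanishes at the
  -- other roots, since these differ from the first.
  too-many-roots : ∀ {n} (cs : Vec X n) (ρ : Fin (suc n) → X) → (∀ {i j} → ρ i ≡ ρ j → i ≡ j) →
                   ¬ (∀ i → monic cs (ρ i) ≡ 0#)
  too-many-roots [] ρ inj root = 1≢0 (root zero)
  too-many-roots cs@(_ ∷ _) ρ inj root =
    too-many-roots (quotient (ρ zero) cs) (ρ ∘ suc) (Fin.suc-injective ∘ inj) (λ i →
      xy≡0⇒y≡0 (λ eq → Fin.0≢1+n (sym (inj (x∙y⁻¹≈ε⇒x≈y _ _ eq))))
        (trans (sym (trans (cong (_+ (ρ (suc i) - ρ zero) * monic (quotient (ρ zero) cs) (ρ (suc i))) (root zero)) (+-identityˡ _)))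
          (trans (sym (monic-factor (ρ zero) cs (ρ (suc i)))) (root (suc i)))))

  monic-replicate : ∀ n x → monic (replicate n 0#) x ≡ x ^ n
  monic-replicate zero x = refl
  monic-replicate (suc n) x = trans (+-identityˡ _) (cong (x *_) (monic-replicate n x))

  -- Otherwise all elements would be roots of X^(d+1) - X, which has at most d + 1 < v of them. The
  -- extra factor X makes 0 a root as well, so any d + 2 elements give the contradiction.
  ∃-^≢1 : ∀ d → 1 ≤ d → suc d < v → ∃[ x ] x ≢ 0# × x ^ d ≢ 1#
  ∃-^≢1 d@(suc d′) _ 1+d<v with Fin.¬∀⟶∃¬ v (λ x → x * x ^ d ≡ x) (λ x → x * x ^ d Fin.≟ x) all-roots
    where
    all-roots : ¬ (∀ x → x * x ^ d ≡ x)
    all-roots all = too-many-roots (0# ∷ (- 1#) ∷ replicate d′ 0#) (λ i → Fin.inject≤ i 1+d<v)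
      (Fin.inject≤-injective 1+d<v 1+d<v _ _) (λ i → root (Fin.inject≤ i 1+d<v))
      where
      root : ∀ x → 0# + x * (- 1# + x * monic (replicate d′ 0#) x) ≡ 0#
      root x = begin
        0# + x * (- 1# + x * monic (replicate d′ 0#) x)    ≡⟨ +-identityˡ _ ⟩
        x * (- 1# + x * monic (replicate d′ 0#) x)         ≡⟨ cong (λ z → x * (- 1# + x * z)) (monic-replicate d′ x) ⟩
        x * (- 1# + x ^ d)                                 ≡⟨ distribˡ x _ _ ⟩
        x * - 1# + x * x ^ d                               ≡⟨ cong₂ _+_ (trans (sym (-‿distribʳ-* x 1#)) (cong -_ (*-identityʳ x))) (all x) ⟩
        - x + x                                            ≡⟨ -‿inverseˡ x ⟩
        0#                                                 ∎
  ... | x , neq = x , (λ x≡0 → neq (trans (cong (_* x ^ d) x≡0) (trans (zeroˡ _) (sym x≡0)))) ,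
                      (λ x^d≡1 → neq (trans (cong (x *_) x^d≡1) (*-identityʳ x)))

  -- Parameters of the construction and roots of unity

  module Construction {p u : ℕ} (p-prime : Prime p) (params : Parameters (2 ℕ.+ u) v p) where
    open Parameters params

    o : ℕ
    o = proj₁ (powers r)

    -- The exponent of the theorem is `2 + u` here, so `N` is the number of blocks. As v - 1 = 2^r ·
    -- 2N · m, `m` is the odd part of v - 1.
    m N : ℕ
    m = o ℕ.* m′
    N = 2 ℕ.^ suc u

    m-odd : Odd m
    m-odd = odd-* (proj₁ (proj₂ (powers r))) m′-odd

    v≡1+ : v ≡ suc (2 ℕ.^ r ℕ.* o ℕ.* (2 ℕ.* N ℕ.* m′))
    v≡1+ = trans v≡ (proj₂ (proj₂ (powers r)))

    half : ℕ
    half = 2 ℕ.^ r ℕ.* o ℕ.* (N ℕ.* m′)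

    v≡1+2half : v ≡ suc (2 ℕ.* half)
    v≡1+2half = trans v≡1+ (cong suc (alg (2 ℕ.^ r) o N m′))
      where
      alg : ∀ a b c d → a ℕ.* b ℕ.* (2 ℕ.* c ℕ.* d) ≡ 2 ℕ.* (a ℕ.* b ℕ.* (c ℕ.* d))
      alg = ℕ-Solver.solve-∀

    p·1≡0 : p · 1# ≡ 0#
    p·1≡0 = characteristic (n ℕ.* 2 ℕ.^ r) (trans v≡ (trans (cong (ℕ._^ (2 ℕ.^ r)) q≡pⁿ) (ℕ.^-*-assoc p n _)))

    φ-+ : ∀ x y → (x + y) ^ q ≡ x ^ q + y ^ q
    φ-+ x y = subst (λ k → (x + y) ^ k ≡ x ^ k + y ^ k) (sym q≡pⁿ) (frobenius-+ p-prime p·1≡0 n x y)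

    -- Since v · 1 = 0, a vanishing d · 1 would give 1 = 0. The case d = 2 yields odd
    -- characteristic, the case d = 2^r a nonzero trace of 1.
    coprime-to-v : ∀ d k → v ≡ suc (d ℕ.* k) → d · 1# ≢ 0#
    coprime-to-v d k v≡1+dk d≡0 = 1≢0 (begin
      1#                              ≡⟨ +-identityʳ 1# ⟨
      1# + 0#                         ≡⟨ cong (λ z → 1# + z) (zeroˡ (k · 1#)) ⟨
      1# + 0# * (k · 1#)              ≡⟨ cong (λ z → 1# + z * (k · 1#)) d≡0 ⟨
      1# + (d · 1#) * (k · 1#)        ≡⟨ cong (1# +_) (×1-homo-* d k) ⟨
      suc (d ℕ.* k) · 1#              ≡⟨ cong (_· 1#) v≡1+dk ⟨
      v · 1#                          ≡⟨ v·1≡0 ⟩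
      0#                              ∎)

    x≢-x : ∀ {x} → x ≢ 0# → x ≢ - x
    x≢-x {x} x≢0 x≡-x = coprime-to-v 2 half v≡1+2half
      (xy≡0⇒y≡0 x≢0 (begin
        x * (1# + (1# + 0#))          ≡⟨ cong (λ z → x * (1# + z)) (+-identityʳ 1#) ⟩
        x * (1# + 1#)                 ≡⟨ distribˡ x 1# 1# ⟩
        x * 1# + x * 1#               ≡⟨ cong₂ _+_ (*-identityʳ x) (trans (*-identityʳ x) x≡-x) ⟩
        x - x                         ≡⟨ -‿inverseʳ x ⟩
        0#                            ∎))

    [-1]²≡1 : - 1# * - 1# ≡ 1#
    [-1]²≡1 = trans (-1*x≈-x (- 1#)) (-‿involutive 1#)

    [-1]^odd : ∀ {k} → Odd k → (- 1#) ^ k ≡ - 1#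
    [-1]^odd (j , refl) = trans (cong (- 1# *_)
      (trans (sym (^-assocʳ (- 1#) 2 j)) (trans (cong (_^ j) (trans (cong (- 1# *_) (*-identityʳ _)) [-1]²≡1)) (1^ j)))) (*-identityʳ _)

    square-root-of-1 : ∀ y → y * y ≡ 1# → y ≢ 1# → y ≡ - 1#
    square-root-of-1 y yy≡1 y≢1 with (1# + y) Fin.≟ 0#
    ... | yes 1+y≡0 = negative-unique 1# y 1+y≡0
    ... | no 1+y≢0 = ⊥-elim (y≢1 (*-cancelˡ-≢0 1+y≢0 (begin
      (1# + y) * y         ≡⟨ distribʳ y 1# y ⟩
      1# * y + y * y       ≡⟨ cong₂ _+_ (*-identityˡ y) yy≡1 ⟩
      y + 1#               ≡⟨ +-comm y 1# ⟩
      1# + y               ≡⟨ *-identityʳ _ ⟨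
      (1# + y) * 1#        ∎)))

    square-roots-of-1 : ∀ {y} → y * y ≡ 1# → y ≡ 1# ⊎ y ≡ - 1#
    square-roots-of-1 {y} yy≡1 with y Fin.≟ 1#
    ... | yes y≡1 = inj₁ y≡1
    ... | no y≢1 = inj₂ (square-root-of-1 y yy≡1 y≢1)

    ^2* : ∀ x k → x ^ (2 ℕ.* k) ≡ x ^ k * x ^ k
    ^2* x k = trans (cong (x ^_) (cong (k ℕ.+_) (ℕ.+-identityʳ k))) (^-homo-* x k k)

    [-x]^odd : ∀ {k} x → Odd k → (- x) ^ k ≡ - (x ^ k)
    [-x]^odd {k} x odd = begin
      (- x) ^ k                ≡⟨ cong (_^ k) (-1*x≈-x x) ⟨
      (- 1# * x) ^ k           ≡⟨ ^-distrib-* (- 1#) x k ⟩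
      (- 1#) ^ k * x ^ k       ≡⟨ cong (_* x ^ k) ([-1]^odd odd) ⟩
      - 1# * x ^ k             ≡⟨ -1*x≈-x _ ⟩
      - (x ^ k)                ∎

    x^[v-1]≡1 : ∀ {x} k → v ≡ suc k → x ≢ 0# → x ^ k ≡ 1#
    x^[v-1]≡1 {x} k v≡1+k x≢0 = *-cancelˡ-≢0 x≢0 (trans (trans (cong (x ^_) (sym v≡1+k)) (x^v≡x x)) (sym (*-identityʳ x)))

    1≤odd : ∀ {k} → Odd k → 1 ≤ k
    1≤odd (_ , refl) = s≤s z≤n

    -- If x^((v-1)/2) is not 1, it is the other square root of 1. As N divides (v-1)/2, this is an
    -- N-th power.
    τ-exists : ∃[ t ] t ^ N ≡ - 1#
    τ-exists with ∃-^≢1 half 1≤half (subst (suc (suc half) ≤_) (sym v≡1+2half) (s≤s (ℕ.+-mono-≤ 1≤half (ℕ.m≤m+n half 0))))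
      where
      1≤half : 1 ≤ half
      1≤half = ℕ.*-mono-≤ (ℕ.*-mono-≤ (ℕ.m^n>0 2 r) (1≤odd (proj₁ (proj₂ (powers r))))) (ℕ.*-mono-≤ (ℕ.m^n>0 2 (suc u)) (1≤odd m′-odd))
    ... | x , x≢0 , x^half≢1 = x ^ e , (begin
      (x ^ e) ^ N      ≡⟨ ^-assocʳ x e N ⟩
      x ^ (e ℕ.* N)    ≡⟨ cong (x ^_) (alg (2 ℕ.^ r) o m′ N) ⟩
      x ^ half            ≡⟨ square-root-of-1 (x ^ half) (trans (sym (^2* x half)) (x^[v-1]≡1 (2 ℕ.* half) v≡1+2half x≢0)) x^half≢1 ⟩
      - 1#             ∎)
      where
      e = 2 ℕ.^ r ℕ.* o ℕ.* m′
      alg : ∀ a b c d → a ℕ.* b ℕ.* c ℕ.* d ≡ a ℕ.* b ℕ.* (d ℕ.* c)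
      alg = ℕ-Solver.solve-∀

    τ : X
    τ = proj₁ τ-exists

    τ^N≡-1 : τ ^ N ≡ - 1#
    τ^N≡-1 = proj₂ τ-exists

    -1≢0 : - 1# ≢ 0#
    -1≢0 eq = 1≢0 (trans (sym (-‿involutive 1#)) (trans (cong -_ eq) -0#≈0#))

    τ≢0 : τ ≢ 0#
    τ≢0 τ≡0 = -1≢0 (trans (sym τ^N≡-1) (trans (cong (_^ N) τ≡0) (0^ N (ℕ.m^n>0 2 (suc u)))))

    -- The trace to the field of q elements

    0^q≡0 : 0# ^ q ≡ 0#
    0^q≡0 = trans (cong (0# ^_) q≡) (zeroˡ _)

    -- Horner form of x + x^q + ... + x^(q^(n-1)). For n = 2^r this is the trace to the subfield K,
    -- whose elements appear below as the solutions of `k ^ q ≡ k`.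
    Tr : ℕ → X → X
    Tr zero x = 0#
    Tr (suc n) x = x + Tr n x ^ q

    Tr-+ : ∀ n x y → Tr n (x + y) ≡ Tr n x + Tr n y
    Tr-+ zero x y = sym (+-identityˡ 0#)
    Tr-+ (suc n) x y = trans (cong (x + y +_) (trans (cong (_^ q) (Tr-+ n x y)) (φ-+ _ _))) (+-interchange x y _ _)

    Tr-* : ∀ {k} → k ^ q ≡ k → ∀ n x → Tr n (k * x) ≡ k * Tr n x
    Tr-* {k} kq≡k zero x = sym (zeroʳ k)
    Tr-* {k} kq≡k (suc n) x = begin
      k * x + Tr n (k * x) ^ q          ≡⟨ cong (λ z → k * x + z ^ q) (Tr-* kq≡k n x) ⟩
      k * x + (k * Tr n x) ^ q          ≡⟨ cong (k * x +_) (trans (^-distrib-* k _ q) (cong (_* Tr n x ^ q) kq≡k)) ⟩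
      k * x + k * Tr n x ^ q            ≡⟨ distribˡ k x _ ⟨
      k * (x + Tr n x ^ q)              ∎

    Tr-^q : ∀ n x → Tr n x ^ q ≡ Tr n (x ^ q)
    Tr-^q zero x = 0^q≡0
    Tr-^q (suc n) x = trans (φ-+ x _) (cong (λ z → x ^ q + z ^ q) (Tr-^q n x))

    Tr-last : ∀ n x → Tr (suc n) x ≡ Tr n x + x ^ (q ℕ.^ n)
    Tr-last zero x = trans (cong (x +_) 0^q≡0) (trans (+-comm x 0#) (cong (0# +_) (sym (*-identityʳ x))))
    Tr-last (suc n) x = begin
      x + Tr (suc n) x ^ q                       ≡⟨ cong (λ z → x + z ^ q) (Tr-last n x) ⟩
      x + (Tr n x + x ^ (q ℕ.^ n)) ^ q           ≡⟨ cong (x +_) (φ-+ _ _) ⟩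
      x + (Tr n x ^ q + (x ^ (q ℕ.^ n)) ^ q)     ≡⟨ +-assoc x _ _ ⟨
      Tr (suc n) x + (x ^ (q ℕ.^ n)) ^ q         ≡⟨ cong (Tr (suc n) x +_) (trans (^-assocʳ x (q ℕ.^ n) q) (cong (x ^_) (ℕ.*-comm (q ℕ.^ n) q))) ⟩
      Tr (suc n) x + x ^ (q ℕ.^ suc n)           ∎

    Tr-1 : ∀ n → Tr n 1# ≡ n · 1#
    Tr-1 zero = refl
    Tr-1 (suc n) = trans (Tr-last n 1#) (trans (cong₂ _+_ (Tr-1 n) (1^ (q ℕ.^ n))) (+-comm _ 1#))

    T : X → X
    T = Tr (2 ℕ.^ r)

    -- `Tr (suc (2 ^ r)) x` is x + T(x)^q by definition and T(x) + x^v by `Tr-last`, and x^v = x.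
    -- Hence `T` takes its values in K.
    T^q≡T : ∀ x → T x ^ q ≡ T x
    T^q≡T x = +-cancelˡ x _ _ (begin
      x + T x ^ q                       ≡⟨ Tr-last (2 ℕ.^ r) x ⟩
      T x + x ^ (q ℕ.^ (2 ℕ.^ r))       ≡⟨ cong (λ e → T x + x ^ e) v≡ ⟨
      T x + x ^ v                       ≡⟨ cong (T x +_) (x^v≡x x) ⟩
      T x + x                           ≡⟨ +-comm _ x ⟩
      x + T x                           ∎)

    T-^q^ : ∀ j x → T (x ^ (q ℕ.^ j)) ≡ T x
    T-^q^ zero x = cong T (*-identityʳ x)
    T-^q^ (suc j) x = begin
      T (x ^ (q ℕ.* q ℕ.^ j))       ≡⟨ cong T (^-assocʳ x q _) ⟨
      T ((x ^ q) ^ (q ℕ.^ j))       ≡⟨ T-^q^ j (x ^ q) ⟩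
      T (x ^ q)                     ≡⟨ Tr-^q (2 ℕ.^ r) x ⟨
      T x ^ q                       ≡⟨ T^q≡T x ⟩
      T x                           ∎

    T-* : ∀ {k} → k ^ q ≡ k → ∀ x → T (k * x) ≡ k * T x
    T-* kq≡k = Tr-* kq≡k (2 ℕ.^ r)

    T0≡0 : T 0# ≡ 0#
    T0≡0 = trans (cong T (sym (zeroˡ 0#))) (trans (T-* 0^q≡0 0#) (zeroˡ _))

    -- The trace of 1 is 2^r · 1, and 2^r divides v - 1. This will make `∣kerTᶜ∣` positive.
    T1≢0 : T 1# ≢ 0#
    T1≢0 eq = coprime-to-v (2 ℕ.^ r) (o ℕ.* (2 ℕ.* N ℕ.* m′))
      (trans v≡1+ (cong suc (ℕ.*-assoc (2 ℕ.^ r) o _))) (trans (sym (Tr-1 (2 ℕ.^ r))) eq)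

    q-odd : Odd q
    q-odd = N ℕ.* m′ , trans q≡ (cong suc (ℕ.*-assoc 2 N m′))

    T-- : ∀ x y → T (x - y) ≡ T x - T y
    T-- x y = trans (Tr-+ (2 ℕ.^ r) x (- y)) (cong (T x +_) (begin
      T (- y)           ≡⟨ cong T (-1*x≈-x y) ⟨
      T (- 1# * y)      ≡⟨ T-* ([-1]^odd q-odd) y ⟩
      - 1# * T y        ≡⟨ -1*x≈-x (T y) ⟩
      - T y             ∎))

    -- The group L is the kernel of κ on the nonzero elements.
    κ : X → X
    κ x = x ^ (m ℕ.* (2 ℕ.* N))

    κ-* : ∀ x y → κ (x * y) ≡ κ x * κ y
    κ-* x y = ^-distrib-* x y (m ℕ.* (2 ℕ.* N))

    -- K* has order q - 1 = 2Nm′, a divisor of 2Nm, and so lies in L.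
    κ-K : ∀ {k} → k ≢ 0# → k ^ q ≡ k → κ k ≡ 1#
    κ-K {k} k≢0 kq≡k = begin
      k ^ (m ℕ.* (2 ℕ.* N))             ≡⟨ cong (k ^_) (alg o m′ N) ⟩
      k ^ (2 ℕ.* N ℕ.* m′ ℕ.* o)        ≡⟨ ^-assocʳ k (2 ℕ.* N ℕ.* m′) o ⟨
      (k ^ (2 ℕ.* N ℕ.* m′)) ^ o        ≡⟨ cong (_^ o) k^[q-1]≡1 ⟩
      1# ^ o                            ≡⟨ 1^ o ⟩
      1#                                ∎
      where
      alg : ∀ a b c → a ℕ.* b ℕ.* (2 ℕ.* c) ≡ 2 ℕ.* c ℕ.* b ℕ.* a
      alg = ℕ-Solver.solve-∀
      k^[q-1]≡1 : k ^ (2 ℕ.* N ℕ.* m′) ≡ 1#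
      k^[q-1]≡1 = *-cancelˡ-≢0 k≢0 (trans (trans (cong (k ^_) (sym q≡)) kq≡k) (sym (*-identityʳ k)))

    κ0≡0 : κ 0# ≡ 0#
    κ0≡0 = 0^ (m ℕ.* (2 ℕ.* N)) (ℕ.*-mono-≤ (1≤odd m-odd) (ℕ.m^n>0 2 (2 ℕ.+ u)))

    κ1≡1 : κ 1# ≡ 1#
    κ1≡1 = 1^ (m ℕ.* (2 ℕ.* N))

    κ-≢0 : ∀ {x} → x ≢ 0# → κ x ≢ 0#
    κ-≢0 = ^-≢0 (m ℕ.* (2 ℕ.* N))

    -- The nonempty fibres of `κ` on nonzero elements are the cosets of L. Their orders divide 2^r,
    -- so the descent in `Tower` can start at i = r.
    κ-top : ∀ {x} → x ≢ 0# → κ x ^ (2 ℕ.^ r) ≡ 1#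
    κ-top {x} x≢0 = trans (^-assocʳ x (m ℕ.* (2 ℕ.* N)) (2 ℕ.^ r)) (x^[v-1]≡1 _ (trans v≡1+ (cong suc (alg (2 ℕ.^ r) o N m′))) x≢0)
      where
      alg : ∀ a b c d → a ℕ.* b ℕ.* (2 ℕ.* c ℕ.* d) ≡ b ℕ.* d ℕ.* (2 ℕ.* c) ℕ.* a
      alg = ℕ-Solver.solve-∀

    κ-^m≡-1 : ∀ {z} → z ^ m ≡ - 1# → κ z ≡ 1#
    κ-^m≡-1 {z} z^m≡-1 = begin
      z ^ (m ℕ.* (2 ℕ.* N))         ≡⟨ ^-assocʳ z m (2 ℕ.* N) ⟨
      (z ^ m) ^ (2 ℕ.* N)           ≡⟨ cong (_^ (2 ℕ.* N)) z^m≡-1 ⟩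
      (- 1#) ^ (2 ℕ.* N)            ≡⟨ ^2* (- 1#) N ⟩
      (- 1#) ^ N * (- 1#) ^ N       ≡⟨ ^-distrib-* (- 1#) (- 1#) N ⟨
      (- 1# * - 1#) ^ N             ≡⟨ cong (_^ N) [-1]²≡1 ⟩
      1# ^ N                        ≡⟨ 1^ N ⟩
      1#                            ∎

    -- Equivalently, f is odd and invariant under the elements of odd order.
    Skew : (X → ℤ) → Set
    Skew f = ∀ {z} x → z ^ m ≡ - 1# → f (z * x) ≡ ℤ.- f x

    skew-neg : ∀ {f} → Skew f → ∀ x → f (- 1# * x) ≡ ℤ.- f x
    skew-neg skew x = skew x ([-1]^odd m-odd)

    skew-0 : ∀ {f} → Skew f → f 0# ≡ 0ℤ
    skew-0 {f} skew = i≡-i⇒i≡0 (trans (cong f (sym (zeroʳ (- 1#)))) (skew-neg skew 0#))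

    skew-scale : ∀ {f} c → Skew f → Skew (λ x → f (c * x))
    skew-scale {f} c skew {z} x z^m≡-1 = trans (cong f (x∙yz≈y∙xz c z x)) (skew (c * x) z^m≡-1)

    -- Autocorrelations and the hyperplane transform

    ∑-scale : (f : X → ℤ) {a : X} → a ≢ 0# → ∑ f ≡ ∑ (λ x → f (a * x))
    ∑-scale = sum-scale ℤ.+-0-commutativeMonoid

    ∑-translate : (f : X → ℤ) (a : X) → ∑ f ≡ ∑ (λ x → f (x + a))
    ∑-translate = sum-translate ℤ.+-0-commutativeMonoid

    ∑-skew : ∀ {f} → Skew f → ∑ f ≡ 0ℤ
    ∑-skew {f} skew = i≡-i⇒i≡0 (trans (∑-scale f -1≢0) (trans (∑-cong (skew-neg skew)) (∑-neg f)))

    A : (X → ℤ) → X → ℤ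
    A f g = ∑ λ x → f (x + g) ℤ.* f x

    -- The level k = 0 is the hyperplane transform. The other levels enter through `E-square` and
    -- through the inversion.
    S : (X → ℤ) → X → X → ℤ
    S f b k = ∑ λ x → δ (T (b * x)) k ℤ.* f x

    -- The contribution of a single function to `Φ`.
    E : (X → ℤ) → X → ℤ
    E f b = S (A f) b 0#

    ∣kerT∣ ∣kerTᶜ∣ : ℤ
    ∣kerT∣ = ∑ λ b → δ (T b) 0#
    ∣kerTᶜ∣ = ∑ (λ (b : X) → 1ℤ) ℤ.- ∣kerT∣

    ∑-A : ∀ f → ∑ (A f) ≡ ∑ f ℤ.* ∑ f
    ∑-A f = begin
      ∑ (λ g → ∑ λ x → f (x + g) ℤ.* f x)     ≡⟨ ∑-swap (λ g x → f (x + g) ℤ.* f x) ⟩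
      ∑ (λ x → ∑ λ g → f (x + g) ℤ.* f x)     ≡⟨ ∑-cong (λ x → *-distribʳ-sum (f x) (λ g → f (x + g))) ⟨
      ∑ (λ x → ∑ (λ g → f (x + g)) ℤ.* f x)   ≡⟨ ∑-cong (λ x → cong (ℤ._* f x) (trans (∑-cong (λ g → cong f (+-comm x g))) (sym (∑-translate f x)))) ⟩
      ∑ (λ x → ∑ f ℤ.* f x)                   ≡⟨ *-distribˡ-sum (∑ f) f ⟨
      ∑ f ℤ.* ∑ f                             ∎

    ∑-A-skew : ∀ {f} → Skew f → ∑ (A f) ≡ 0ℤ
    ∑-A-skew {f} skew = trans (∑-A f) (cong (λ s → s ℤ.* ∑ f) (∑-skew skew))

    -- The translation g ↦ g + x carries the hyperplane of b to the level of T(b ·) through x.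
    shift-level : ∀ a b x → ∑ (λ g → δ (T (b * g)) 0# ℤ.* a (g + x)) ≡ S a b (T (b * x))
    shift-level a b x = trans (∑-translate (λ g → δ (T (b * g)) 0# ℤ.* a (g + x)) (- x)) (∑-cong (λ y →
      cong₂ ℤ._*_ (δ-⇔ (λ eq → x∙y⁻¹≈ε⇒x≈y _ _ (trans (sym (expand y)) eq))
                       (λ eq → trans (expand y) (trans (cong (_- T (b * x)) eq) (-‿inverseʳ _))))
                  (cong a (x-y+y≡x y x))))
      where
      expand : ∀ y → T (b * (y - x)) ≡ T (b * y) - T (b * x)
      expand y = trans (cong T (x[y-z]≈xy-xz b y x)) (T-- (b * y) (b * x))

    -- Parseval for the hyperplane transform: every g ≠ 0 lies in equally many hyperplanes T(bg) = 0.
    radon : ∀ {a} → ∑ a ≡ 0ℤ → ∑ (λ b → S a b 0#) ≡ ∣kerTᶜ∣ ℤ.* a 0#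
    radon {a} ∑a≡0 = begin
      ∑ (λ b → ∑ λ g → δ (T (b * g)) 0# ℤ.* a g)       ≡⟨ ∑-swap (λ b g → δ (T (b * g)) 0# ℤ.* a g) ⟩
      ∑ (λ g → ∑ λ b → δ (T (b * g)) 0# ℤ.* a g)       ≡⟨ ∑-cong (λ g → *-distribʳ-sum (a g) (λ b → δ (T (b * g)) 0#)) ⟨
      ∑ (λ g → ∑ (λ b → δ (T (b * g)) 0#) ℤ.* a g)     ≡⟨ ∑-cong (λ g → trans (cong (ℤ._* a g) (count g)) (alg ∣kerT∣ ∣kerTᶜ∣ (δ 0# g) (a g))) ⟩
      ∑ (λ g → ∣kerT∣ ℤ.* a g ℤ.+ ∣kerTᶜ∣ ℤ.* (δ 0# g ℤ.* a g))   ≡⟨ ∑-+ (λ g → ∣kerT∣ ℤ.* a g) (λ g → ∣kerTᶜ∣ ℤ.* (δ 0# g ℤ.* a g)) ⟩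
      ∑ (λ g → ∣kerT∣ ℤ.* a g) ℤ.+ ∑ (λ g → ∣kerTᶜ∣ ℤ.* (δ 0# g ℤ.* a g))
        ≡⟨ cong₂ ℤ._+_ (sym (*-distribˡ-sum ∣kerT∣ a)) (sym (*-distribˡ-sum ∣kerTᶜ∣ (λ g → δ 0# g ℤ.* a g))) ⟩
      ∣kerT∣ ℤ.* ∑ a ℤ.+ ∣kerTᶜ∣ ℤ.* ∑ (λ g → δ 0# g ℤ.* a g)     ≡⟨ cong₂ ℤ._+_ (trans (cong (∣kerT∣ ℤ.*_) ∑a≡0) (ℤ.*-zeroʳ ∣kerT∣)) (cong (∣kerTᶜ∣ ℤ.*_) (∑-δ 0# a)) ⟩
      0ℤ ℤ.+ ∣kerTᶜ∣ ℤ.* a 0#                                ≡⟨ ℤ.+-identityˡ (∣kerTᶜ∣ ℤ.* a 0#) ⟩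
      ∣kerTᶜ∣ ℤ.* a 0#                                       ∎
      where
      alg : ∀ z h d a → (z ℤ.+ d ℤ.* h) ℤ.* a ≡ z ℤ.* a ℤ.+ h ℤ.* (d ℤ.* a)
      alg = ℤ-Solver.solve-∀
      alg₁ : ∀ z c → c ≡ z ℤ.+ 1ℤ ℤ.* (c ℤ.- z)
      alg₁ = ℤ-Solver.solve-∀
      count : ∀ g → ∑ (λ b → δ (T (b * g)) 0#) ≡ ∣kerT∣ ℤ.+ δ 0# g ℤ.* ∣kerTᶜ∣
      count g with 0# Fin.≟ g
      ... | yes refl = trans (∑-cong (λ b → δ-yes (trans (cong T (zeroʳ b)) T0≡0))) (alg₁ ∣kerT∣ (∑ (λ (b : X) → 1ℤ)))
      ... | no 0≢g = trans (∑-cong (λ b → cong (λ y → δ (T y) 0#) (*-comm b g)))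
        (trans (sym (∑-scale (λ b → δ (T b) 0#) (0≢g ∘ sym))) (sym (ℤ.+-identityʳ ∣kerT∣)))

    -- Both sides sum f(x) f(y) over all pairs with T(bx) = T(by).
    E-square : ∀ f b → E f b ≡ ∑ (λ k → S f b k ℤ.* S f b k)
    E-square f b = trans lhs (sym rhs)
      where
      D : X → ℤ
      D g = δ (T (b * g)) 0#
      alg : ∀ d y x → d ℤ.* (y ℤ.* x) ≡ x ℤ.* (d ℤ.* y)
      alg = ℤ-Solver.solve-∀
      alg′ : ∀ d x s → (d ℤ.* x) ℤ.* s ≡ d ℤ.* (x ℤ.* s)
      alg′ = ℤ-Solver.solve-∀
      lhs : E f b ≡ ∑ (λ x → f x ℤ.* S f b (T (b * x)))
      lhs = begin
        ∑ (λ g → D g ℤ.* ∑ λ x → f (x + g) ℤ.* f x)      ≡⟨ ∑-cong (λ g → *-distribˡ-sum (D g) (λ x → f (x + g) ℤ.* f x)) ⟩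
        ∑ (λ g → ∑ λ x → D g ℤ.* (f (x + g) ℤ.* f x))    ≡⟨ ∑-swap (λ g x → D g ℤ.* (f (x + g) ℤ.* f x)) ⟩
        ∑ (λ x → ∑ λ g → D g ℤ.* (f (x + g) ℤ.* f x))
          ≡⟨ ∑-cong (λ x → ∑-cong (λ g → trans (alg (D g) (f (x + g)) (f x)) (cong (λ y → f x ℤ.* (D g ℤ.* f y)) (+-comm x g)))) ⟩
        ∑ (λ x → ∑ λ g → f x ℤ.* (D g ℤ.* f (g + x)))    ≡⟨ ∑-cong (λ x → *-distribˡ-sum (f x) (λ g → D g ℤ.* f (g + x))) ⟨
        ∑ (λ x → f x ℤ.* ∑ (λ g → D g ℤ.* f (g + x)))    ≡⟨ ∑-cong (λ x → cong (f x ℤ.*_) (shift-level f b x)) ⟩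
        ∑ (λ x → f x ℤ.* S f b (T (b * x)))              ∎
      rhs : ∑ (λ k → S f b k ℤ.* S f b k) ≡ ∑ (λ x → f x ℤ.* S f b (T (b * x)))
      rhs = begin
        ∑ (λ k → S f b k ℤ.* S f b k)                                     ≡⟨ ∑-cong (λ k → *-distribʳ-sum (S f b k) (λ x → δ (T (b * x)) k ℤ.* f x)) ⟩
        ∑ (λ k → ∑ λ x → (δ (T (b * x)) k ℤ.* f x) ℤ.* S f b k)           ≡⟨ ∑-swap (λ k x → (δ (T (b * x)) k ℤ.* f x) ℤ.* S f b k) ⟩
        ∑ (λ x → ∑ λ k → (δ (T (b * x)) k ℤ.* f x) ℤ.* S f b k)           ≡⟨ ∑-cong (λ x → trans (∑-cong (λ k → alg′ (δ (T (b * x)) k) (f x) (S f b k))) (∑-δ (T (b * x)) (λ k → f x ℤ.* S f b k))) ⟩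
        ∑ (λ x → f x ℤ.* S f b (T (b * x)))                               ∎

    -- The substitution x ↦ x^Q, Q = q^(2^i), preserves T and changes the sign of f where κ(x)^(2^i) = -1.
    module Tower {f : X → ℤ} (skew : Skew f) (k : X) where

      -- Only those x count whose coset of L has order dividing 2^i: all nonzero x for i = r, only L
      -- for i = 0.
      W : ℕ → ℤ
      W i = ∑ λ x → δ (T x) k ℤ.* (δ (κ x ^ (2 ℕ.^ i)) 1# ℤ.* f x)

      module Step (i : ℕ) (i≤r : 2 ℕ.^ i ≤ 2 ℕ.^ r) where
        -- The map x ↦ x^Q′ inverts x ↦ x^Q, because Q Q′ = v.
        Q Q′ : ℕ
        Q = q ℕ.^ (2 ℕ.^ i)
        Q′ = q ℕ.^ (2 ℕ.^ r ℕ.∸ 2 ℕ.^ i)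

        Q*Q′≡v : Q ℕ.* Q′ ≡ v
        Q*Q′≡v = trans (sym (ℕ.^-distribˡ-+-* q (2 ℕ.^ i) (2 ℕ.^ r ℕ.∸ 2 ℕ.^ i))) (trans (cong (q ℕ.^_) (ℕ.m+[n∸m]≡n i≤r)) (sym v≡))

        [x^Q]^Q′≡x : ∀ x → (x ^ Q) ^ Q′ ≡ x
        [x^Q]^Q′≡x x = trans (^-assocʳ x Q Q′) (trans (cong (x ^_) Q*Q′≡v) (x^v≡x x))

        [x^Q′]^Q≡x : ∀ x → (x ^ Q′) ^ Q ≡ x
        [x^Q′]^Q≡x x = trans (^-assocʳ x Q′ Q) (trans (cong (x ^_) (trans (ℕ.*-comm Q′ Q) Q*Q′≡v)) (x^v≡x x))

        ∑-^Q : (h : X → ℤ) → ∑ h ≡ ∑ (λ x → h (x ^ Q))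
        ∑-^Q h = sum-reindex ℤ.+-0-commutativeMonoid h (_^ Q) (_^ Q′) [x^Q′]^Q≡x [x^Q]^Q′≡x

        δ-^Q : ∀ e x → δ ((x ^ Q) ^ e) 1# ≡ δ (x ^ e) 1#
        δ-^Q e x = δ-⇔
          (λ eq → trans (sym ([x^Q]^Q′≡x (x ^ e))) (trans (cong (_^ Q′) (trans (^-comm x e Q) eq)) (1^ Q′)))
          (λ eq → trans (sym (^-comm x e Q)) (trans (cong (_^ Q) eq) (1^ Q)))
          where
          ^-comm : ∀ x a b → (x ^ a) ^ b ≡ (x ^ b) ^ a
          ^-comm x a b = trans (^-assocʳ x a b) (trans (cong (x ^_) (ℕ.*-comm a b)) (sym (^-assocʳ x b a)))

        -- By `powers`, Q - 1 = 2^i a · 2Nm′ with a odd. Hence z = x^(Q-1) satisfies z^m = κ(x)^(2^i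
        -- a m′) = -1, because a and m′ are odd, and skewness applies to x^Q = zx.
        f-^Q : ∀ {x} → κ x ^ (2 ℕ.^ i) ≡ - 1# → f (x ^ Q) ≡ ℤ.- f x
        f-^Q {x} eq with powers i
        ... | a , a-odd , Q≡ = trans (cong f (trans (cong (x ^_) Q≡) (*-comm x (x ^ M)))) (skew x (begin
          (x ^ M) ^ m                              ≡⟨ ^-assocʳ x M m ⟩
          x ^ (M ℕ.* m)                            ≡⟨ cong (x ^_) (alg (2 ℕ.^ i) a (2 ℕ.* N) m′ m) ⟩
          x ^ (m ℕ.* (2 ℕ.* N) ℕ.* (2 ℕ.^ i ℕ.* (a ℕ.* m′)))   ≡⟨ ^-assocʳ x (m ℕ.* (2 ℕ.* N)) _ ⟨
          κ x ^ (2 ℕ.^ i ℕ.* (a ℕ.* m′))           ≡⟨ ^-assocʳ (κ x) (2 ℕ.^ i) (a ℕ.* m′) ⟨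
          (κ x ^ (2 ℕ.^ i)) ^ (a ℕ.* m′)           ≡⟨ cong (_^ (a ℕ.* m′)) eq ⟩
          (- 1#) ^ (a ℕ.* m′)                      ≡⟨ [-1]^odd (odd-* a-odd m′-odd) ⟩
          - 1#                                     ∎))
          where
          M = 2 ℕ.^ i ℕ.* a ℕ.* (2 ℕ.* N ℕ.* m′)
          alg : ∀ w a c m′ m → w ℕ.* a ℕ.* (c ℕ.* m′) ℕ.* m ≡ m ℕ.* c ℕ.* (w ℕ.* (a ℕ.* m′))
          alg = ℕ-Solver.solve-∀

        -- The indicator of κ(x)^(2^i) = -1, that is, of the cosets of L of order exactly 2^(i+1).
        Δ : X → ℤ
        Δ x = δ (κ x ^ (2 ℕ.^ suc i)) 1# ℤ.- δ (κ x ^ (2 ℕ.^ i)) 1#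

        Δ-^Q : ∀ x → Δ (x ^ Q) ≡ Δ x
        Δ-^Q x = cong₂ ℤ._-_ (step (suc i)) (step i)
          where
          step : ∀ j → δ (κ (x ^ Q) ^ (2 ℕ.^ j)) 1# ≡ δ (κ x ^ (2 ℕ.^ j)) 1#
          step j = trans (cong (λ y → δ y 1#) (^-assocʳ (x ^ Q) (m ℕ.* (2 ℕ.* N)) (2 ℕ.^ j)))
            (trans (δ-^Q (m ℕ.* (2 ℕ.* N) ℕ.* 2 ℕ.^ j) x) (cong (λ y → δ y 1#) (sym (^-assocʳ x (m ℕ.* (2 ℕ.* N)) (2 ℕ.^ j)))))

        Δ*f-^Q : ∀ x → Δ x ℤ.* f (x ^ Q) ≡ ℤ.- (Δ x ℤ.* f x)
        Δ*f-^Q x with κ x ^ (2 ℕ.^ i) Fin.≟ 1# | κ x ^ (2 ℕ.^ suc i) Fin.≟ 1#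
        ... | yes _ | yes _ = refl
        ... | no _ | no _ = refl
        ... | yes eq | no neq = ⊥-elim (neq (trans (^2* (κ x) (2 ℕ.^ i)) (trans (cong₂ _*_ eq eq) (*-identityˡ 1#))))
        ... | no neq | yes eq = trans (cong ((1ℤ ℤ.- 0ℤ) ℤ.*_) (f-^Q (square-root-of-1 _ (trans (sym (^2* (κ x) (2 ℕ.^ i))) eq) neq)))
            (sym (ℤ.neg-distribʳ-* (1ℤ ℤ.- 0ℤ) (f x)))

        W-step : W (suc i) ≡ W i
        W-step = begin
          W (suc i)              ≡⟨ ∑-cong (λ x → alg (δ (T x) k) (δ (κ x ^ (2 ℕ.^ suc i)) 1#) (δ (κ x ^ (2 ℕ.^ i)) 1#) (f x)) ⟩
          ∑ (λ x → G x ℤ.+ δ (T x) k ℤ.* (δ (κ x ^ (2 ℕ.^ i)) 1# ℤ.* f x))     ≡⟨ ∑-+ G _ ⟩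
          ∑ G ℤ.+ W i            ≡⟨ cong (ℤ._+ W i) ∑G≡0 ⟩
          0ℤ ℤ.+ W i             ≡⟨ ℤ.+-identityˡ (W i) ⟩
          W i                    ∎
          where
          G : X → ℤ
          G x = δ (T x) k ℤ.* (Δ x ℤ.* f x)
          alg : ∀ t a b y → t ℤ.* (a ℤ.* y) ≡ t ℤ.* ((a ℤ.- b) ℤ.* y) ℤ.+ t ℤ.* (b ℤ.* y)
          alg = ℤ-Solver.solve-∀
          ∑G≡0 : ∑ G ≡ 0ℤ
          ∑G≡0 = i≡-i⇒i≡0 (begin
            ∑ G                          ≡⟨ ∑-^Q G ⟩
            ∑ (λ x → G (x ^ Q))          ≡⟨ ∑-cong (λ x → cong₂ (λ t d → δ t k ℤ.* (d ℤ.* f (x ^ Q))) (T-^q^ (2 ℕ.^ i) x) (Δ-^Q x)) ⟩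
            ∑ (λ x → δ (T x) k ℤ.* (Δ x ℤ.* f (x ^ Q)))
              ≡⟨ ∑-cong (λ x → trans (cong (δ (T x) k ℤ.*_) (Δ*f-^Q x)) (sym (ℤ.neg-distribʳ-* (δ (T x) k) (Δ x ℤ.* f x)))) ⟩
            ∑ (λ x → ℤ.- G x)            ≡⟨ ∑-neg G ⟩
            ℤ.- ∑ G                      ∎)

      W-const : ∀ i → i ≤ r → W i ≡ W 0
      W-const zero _ = refl
      W-const (suc i) i<r = trans (Step.W-step i (ℕ.^-monoʳ-≤ 2 (ℕ.<⇒≤ i<r))) (W-const i (ℕ.<⇒≤ i<r))

    -- Descending from `W r` to `W 0` discards in each step terms that cancel, so that a level sum
    -- of a skew function comes from L alone.
    concentration : ∀ {f} → Skew f → ∀ k → ∑ (λ x → δ (T x) k ℤ.* f x) ≡ ∑ (λ x → δ (T x) k ℤ.* (δ (κ x) 1# ℤ.* f x))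
    concentration {f} skew k = begin
      ∑ (λ x → δ (T x) k ℤ.* f x)                       ≡⟨ ∑-cong (λ x → cong (δ (T x) k ℤ.*_) (top x)) ⟩
      W r                                               ≡⟨ W-const r ℕ.≤-refl ⟩
      W 0                                               ≡⟨ ∑-cong (λ x → cong (λ y → δ (T x) k ℤ.* (δ y 1# ℤ.* f x)) (*-identityʳ (κ x))) ⟩
      ∑ (λ x → δ (T x) k ℤ.* (δ (κ x) 1# ℤ.* f x))      ∎
      where
      open Tower skew k
      top : ∀ x → f x ≡ δ (κ x ^ (2 ℕ.^ r)) 1# ℤ.* f x
      top x with x Fin.≟ 0#
      -- The restriction at i = r excludes only x = 0, where f vanishes anyway.
      ... | yes refl = trans (skew-0 skew) (sym (trans (cong (δ (κ 0# ^ (2 ℕ.^ r)) 1# ℤ.*_) (skew-0 skew)) (ℤ.*-zeroʳ (δ (κ 0# ^ (2 ℕ.^ r)) 1#))))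
      ... | no x≢0 = trans (sym (ℤ.*-identityˡ (f x))) (cong (ℤ._* f x) (sym (δ-yes (κ-top x≢0))))

    -- Localisation to a coset of L

    Unit : (X → ℤ) → Set
    Unit f = ∀ {x} → x ≢ 0# → f x ℤ.* f x ≡ 1ℤ

    factor≢0ʳ : ∀ {b c} → b * c ≡ 1# → c ≢ 0#
    factor≢0ʳ {b} bc≡1 refl = 1≢0 (trans (sym bc≡1) (zeroʳ b))

    ∣L∣ : ℤ
    ∣L∣ = ∑ λ x → δ (κ x) 1#

    S-scale : ∀ f {b c} k → b * c ≡ 1# → S f b k ≡ ∑ (λ y → δ (T y) k ℤ.* f (c * y))
    S-scale f {b} {c} k bc≡1 = trans (∑-scale (λ x → δ (T (b * x)) k ℤ.* f x) (factor≢0ʳ bc≡1))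
      (∑-cong (λ y → cong (λ w → δ (T w) k ℤ.* f (c * y)) (trans (sym (*-assoc b c y)) (trans (cong (_* y) bc≡1) (*-identityˡ y)))))

    -- Cutting s down to the coset b₀⁻¹L preserves skewness, because every z with z^m = -1 lies in
    -- L.
    module Localised {s : X → ℤ} (skew : Skew s) (unit : Unit s) {b₀ : X} (b₀≢0 : b₀ ≢ 0#) where

      f : X → ℤ
      f x = δ (κ (b₀ * x)) 1# ℤ.* s x

      f-skew : Skew f
      f-skew {z} x z^m≡-1 = trans
        (cong₂ (λ a b → δ a 1# ℤ.* b)
          (trans (cong κ (x∙yz≈y∙xz b₀ z x)) (trans (κ-* z (b₀ * x)) (trans (cong (_* κ (b₀ * x)) (κ-^m≡-1 z^m≡-1)) (*-identityˡ _))))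
          (skew x z^m≡-1))
        (sym (ℤ.neg-distribʳ-* (δ (κ (b₀ * x)) 1#) (s x)))

      -- After the substitution x = cy with c = b⁻¹, `concentration` leaves only y in L, hence only
      -- x in b⁻¹L. There `f` is s if b and b₀ lie in the same coset of L, and 0 otherwise.
      S-f : ∀ {b} → b ≢ 0# → ∀ k → S f b k ≡ δ (κ b) (κ b₀) ℤ.* S s b k
      S-f {b} b≢0 k with invertible b b≢0
      ... | c , bc≡1 = begin
        S f b k                                                              ≡⟨ S-scale f k bc≡1 ⟩
        ∑ (λ y → δ (T y) k ℤ.* f (c * y))                                    ≡⟨ concentration (skew-scale c f-skew) k ⟩
        ∑ (λ y → δ (T y) k ℤ.* (δ (κ y) 1# ℤ.* f (c * y)))                   ≡⟨ ∑-cong pointwise ⟩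
        ∑ (λ y → D ℤ.* (δ (T y) k ℤ.* (δ (κ y) 1# ℤ.* s (c * y))))           ≡⟨ *-distribˡ-sum D (λ y → δ (T y) k ℤ.* (δ (κ y) 1# ℤ.* s (c * y))) ⟨
        D ℤ.* ∑ (λ y → δ (T y) k ℤ.* (δ (κ y) 1# ℤ.* s (c * y)))             ≡⟨ cong (D ℤ.*_) (concentration (skew-scale c skew) k) ⟨
        D ℤ.* ∑ (λ y → δ (T y) k ℤ.* s (c * y))                              ≡⟨ cong (D ℤ.*_) (S-scale s k bc≡1) ⟨
        D ℤ.* S s b k                                                        ∎
        where
        D = δ (κ b) (κ b₀)
        κbκc≡1 : κ b * κ c ≡ 1#
        κbκc≡1 = trans (sym (κ-* b c)) (trans (cong κ bc≡1) κ1≡1)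
        expand : ∀ {y} → κ y ≡ 1# → κ (b₀ * (c * y)) ≡ κ b₀ * κ c
        expand {y} κy≡1 = trans (κ-* b₀ (c * y)) (cong (κ b₀ *_) (trans (κ-* c y) (trans (cong (κ c *_) κy≡1) (*-identityʳ _))))
        δ-coset : ∀ {y} → κ y ≡ 1# → δ (κ (b₀ * (c * y))) 1# ≡ D
        δ-coset κy≡1 = δ-⇔
          (λ eq → *-cancelˡ-≢0 (factor≢0ʳ κbκc≡1) (begin
            κ c * κ b              ≡⟨ *-comm (κ c) (κ b) ⟩
            κ b * κ c              ≡⟨ κbκc≡1 ⟩
            1#                     ≡⟨ trans (sym (expand κy≡1)) eq ⟨
            κ b₀ * κ c             ≡⟨ *-comm (κ b₀) (κ c) ⟩
            κ c * κ b₀             ∎))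
          (λ eq → trans (expand κy≡1) (trans (cong (_* κ c) (sym eq)) κbκc≡1))
        alg : ∀ t d s → t ℤ.* (1ℤ ℤ.* (d ℤ.* s)) ≡ d ℤ.* (t ℤ.* (1ℤ ℤ.* s))
        alg = ℤ-Solver.solve-∀
        alg₀ : ∀ t d x y → t ℤ.* (0ℤ ℤ.* x) ≡ d ℤ.* (t ℤ.* (0ℤ ℤ.* y))
        alg₀ = ℤ-Solver.solve-∀
        pointwise : ∀ y → δ (T y) k ℤ.* (δ (κ y) 1# ℤ.* f (c * y)) ≡ D ℤ.* (δ (T y) k ℤ.* (δ (κ y) 1# ℤ.* s (c * y)))
        pointwise y with κ y Fin.≟ 1#
        ... | yes κy≡1 = trans (cong (λ e → δ (T y) k ℤ.* (1ℤ ℤ.* (e ℤ.* s (c * y)))) (δ-coset κy≡1)) (alg (δ (T y) k) D (s (c * y)))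
        ... | no _ = alg₀ (δ (T y) k) D (f (c * y)) (s (c * y))

      E-f : ∀ b → E f b ≡ δ (κ b) (κ b₀) ℤ.* E s b
      E-f b with b Fin.≟ 0#
      -- For b = 0 each level is empty or the whole field, over which f sums to 0. On the right,
      -- κ(0) = 0 differs from κ(b₀).
      ... | yes refl = begin
        E f 0#                                 ≡⟨ E-square f 0# ⟩
        ∑ (λ k → S f 0# k ℤ.* S f 0# k)        ≡⟨ ∑-≡0 (λ k → cong (ℤ._* S f 0# k) (S0≡0 k)) ⟩
        0ℤ ℤ.* E s 0#                          ≡⟨ cong (ℤ._* E s 0#) (δ-no (λ eq → κ-≢0 b₀≢0 (trans (sym eq) κ0≡0))) ⟨
        δ (κ 0#) (κ b₀) ℤ.* E s 0#             ∎
        where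
        S0≡0 : ∀ k → S f 0# k ≡ 0ℤ
        S0≡0 k = trans (∑-cong (λ x → cong (λ w → δ (T w) k ℤ.* f x) (zeroˡ x)))
          (trans (sym (*-distribˡ-sum (δ (T 0#) k) f)) (trans (cong (δ (T 0#) k ℤ.*_) (∑-skew f-skew)) (ℤ.*-zeroʳ (δ (T 0#) k))))
      ... | no b≢0 = begin
        E f b                                  ≡⟨ E-square f b ⟩
        ∑ (λ k → S f b k ℤ.* S f b k)          ≡⟨ ∑-cong (λ k → trans (cong₂ ℤ._*_ (S-f b≢0 k) (S-f b≢0 k)) (square k)) ⟩
        ∑ (λ k → D ℤ.* (S s b k ℤ.* S s b k))  ≡⟨ *-distribˡ-sum D (λ k → S s b k ℤ.* S s b k) ⟨
        D ℤ.* ∑ (λ k → S s b k ℤ.* S s b k)    ≡⟨ cong (D ℤ.*_) (E-square s b) ⟨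
        D ℤ.* E s b                            ∎
        where
        D = δ (κ b) (κ b₀)
        alg₁ : ∀ x → (1ℤ ℤ.* x) ℤ.* (1ℤ ℤ.* x) ≡ 1ℤ ℤ.* (x ℤ.* x)
        alg₁ = ℤ-Solver.solve-∀
        square : ∀ k → (D ℤ.* S s b k) ℤ.* (D ℤ.* S s b k) ≡ D ℤ.* (S s b k ℤ.* S s b k)
        square k with does (κ b Fin.≟ κ b₀)
        ... | true = alg₁ (S s b k)
        ... | false = refl

      A-f-0 : A f 0# ≡ ∣L∣
      A-f-0 = trans (∑-cong pointwise) (sym (∑-scale (λ x → δ (κ x) 1#) b₀≢0))
        where
        alg : ∀ x → (1ℤ ℤ.* x) ℤ.* (1ℤ ℤ.* x) ≡ x ℤ.* x
        alg = ℤ-Solver.solve-∀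
        pointwise : ∀ x → f (x + 0#) ℤ.* f x ≡ δ (κ (b₀ * x)) 1#
        pointwise x = trans (cong (λ y → f y ℤ.* f x) (+-identityʳ x)) square
          where
          square : f x ℤ.* f x ≡ δ (κ (b₀ * x)) 1#
          square with κ (b₀ * x) Fin.≟ 1#
          ... | yes eq = trans (alg (s x)) (unit (λ { refl → 1≢0 (trans (sym eq) (trans (cong κ (zeroʳ b₀)) κ0≡0)) }))
          ... | no _ = refl

      -- By `E-f` the left side is the full sum of `E f`, which `radon` evaluates as a multiple of
      -- the autocorrelation of `f` at 0. That is the size of the support of `f`, so the result
      -- depends on neither s nor b₀.
      E-coset-sum : ∑ (λ b → δ (κ b) (κ b₀) ℤ.* E s b) ≡ ∣kerTᶜ∣ ℤ.* ∣L∣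
      E-coset-sum = trans (sym (∑-cong E-f)) (trans (radon (∑-A-skew f-skew)) (cong (∣kerTᶜ∣ ℤ.*_) A-f-0))

    -- Multiplicative invariance of autocorrelations

    A-scale : ∀ f {c} → c ≢ 0# → ∀ g → A (λ x → f (c * x)) g ≡ A f (c * g)
    A-scale f {c} c≢0 g = trans (∑-cong (λ x → cong (λ y → f y ℤ.* f (c * x)) (distribˡ c x g)))
      (sym (∑-scale (λ x → f (x + c * g) ℤ.* f x) c≢0))

    A-^m≡-1 : ∀ {f} → Skew f → ∀ {z} → z ^ m ≡ - 1# → ∀ g → A f (z * g) ≡ A f g
    A-^m≡-1 {f} skew {z} z^m≡-1 g = trans (sym (A-scale f z≢0 g))
      (∑-cong (λ x → trans (cong₂ ℤ._*_ (skew (x + g) z^m≡-1) (skew x z^m≡-1)) (alg (f (x + g)) (f x))))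
      where
      alg : ∀ a b → ℤ.- a ℤ.* ℤ.- b ≡ a ℤ.* b
      alg = ℤ-Solver.solve-∀
      z≢0 : z ≢ 0#
      z≢0 refl = -1≢0 (trans (sym z^m≡-1) (0^ m (1≤odd m-odd)))

    -- Both -1 and -z have m-th power -1, and z is their product.
    A-^m≡1 : ∀ {f} → Skew f → ∀ {z} → z ^ m ≡ 1# → ∀ g → A f (z * g) ≡ A f g
    A-^m≡1 {f} skew {z} z^m≡1 g = begin
      A f (z * g)                ≡⟨ A-^m≡-1 skew ([-1]^odd m-odd) (z * g) ⟨
      A f (- 1# * (z * g))       ≡⟨ cong (A f) (*-assoc (- 1#) z g) ⟨
      A f ((- 1# * z) * g)       ≡⟨ A-^m≡-1 skew (trans (^-distrib-* (- 1#) z m) (trans (cong₂ _*_ ([-1]^odd m-odd) z^m≡1) (*-identityʳ _))) g ⟩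
      A f g                      ∎

    -- The sign function and the sum of autocorrelations

    lt : X → X → ℤ
    lt x y = if does (x Fin.<? y) then 1ℤ else 0ℤ

    lt-yes : ∀ {x y} → x Fin.< y → lt x y ≡ 1ℤ
    lt-yes {x} {y} x<y = cong (λ b → if b then 1ℤ else 0ℤ) (dec-true (x Fin.<? y) x<y)

    lt-no : ∀ {x y} → ¬ x Fin.< y → lt x y ≡ 0ℤ
    lt-no {x} {y} x≮y = cong (λ b → if b then 1ℤ else 0ℤ) (dec-false (x Fin.<? y) x≮y)

    -- Comparing indices of x^m and -x^m in the enumeration picks one from each such pair.
    s : X → ℤ
    s x = lt (x ^ m) (- (x ^ m)) ℤ.- lt (- (x ^ m)) (x ^ m)

    s-skew : Skew s
    s-skew {z} x z^m≡-1 = trans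
      (cong₂ (λ a b → lt a b ℤ.- lt b a) [zx]^m (trans (cong -_ [zx]^m) (-‿involutive (x ^ m))))
      (alg (lt (- (x ^ m)) (x ^ m)) (lt (x ^ m) (- (x ^ m))))
      where
      alg : ∀ a b → a ℤ.- b ≡ ℤ.- (b ℤ.- a)
      alg = ℤ-Solver.solve-∀
      [zx]^m : (z * x) ^ m ≡ - (x ^ m)
      [zx]^m = trans (^-distrib-* z x m) (trans (cong (_* x ^ m) z^m≡-1) (-1*x≈-x (x ^ m)))

    s-unit : Unit s
    s-unit {x} x≢0 with Fin.<-cmp (x ^ m) (- (x ^ m))
    ... | tri< y<-y _ -y≮y = cong₂ (λ a b → (a ℤ.- b) ℤ.* (a ℤ.- b)) (lt-yes y<-y) (lt-no -y≮y)
    ... | tri≈ _ y≡-y _ = ⊥-elim (x≢-x (^-≢0 m x≢0) y≡-y)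
    ... | tri> y≮-y _ -y<y = cong₂ (λ a b → (a ℤ.- b) ℤ.* (a ℤ.- b)) (lt-no y≮-y) (lt-yes -y<y)

    sᵢ : ℕ → X → ℤ
    sᵢ i x = s (τ ^ i * x)

    sᵢ-skew : ∀ i → Skew (sᵢ i)
    sᵢ-skew i = skew-scale {s} (τ ^ i) s-skew

    sᵢ-unit : ∀ i → Unit (sᵢ i)
    sᵢ-unit i x≢0 = s-unit (*-≢0 (^-≢0 i τ≢0) x≢0)

    -- From here on the sum of autocorrelations is used only through the four properties that follow
    -- its definition.
    opaque
      B : X → ℤ
      B g = ∑ {N} λ i → A (sᵢ (toℕ i)) g

      B-def : ∀ g → B g ≡ ∑ {N} (λ i → A (sᵢ (toℕ i)) g)
      B-def g = refl

      B≡ : ∀ g → B g ≡ ∑ {N} (λ i → A s (τ ^ toℕ i * g))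
      B≡ g = ∑-cong {N} (λ i → A-scale s (^-≢0 (toℕ i) τ≢0) g)

      ∑B≡0 : ∑ B ≡ 0ℤ
      ∑B≡0 = trans (∑-swap {v} {N} (λ g i → A (sᵢ (toℕ i)) g)) (∑-≡0 {N} (λ i → ∑-A-skew {sᵢ (toℕ i)} (sᵢ-skew (toℕ i))))

      S-B : ∀ b → S B b 0# ≡ ∑ {N} (λ i → E (sᵢ (toℕ i)) b)
      S-B b = trans (∑-cong (λ g → *-distribˡ-sum {N} (δ (T (b * g)) 0#) (λ i → A (sᵢ (toℕ i)) g)))
        (∑-swap {v} {N} (λ g i → δ (T (b * g)) 0# ℤ.* A (sᵢ (toℕ i)) g))

    -- Multiplication by τ shifts the summands of `B≡` cyclically. The last one returns to the first
    -- because τ^N = -1 and the autocorrelation of a skew function is even.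
    B-τ : ∀ g → B (τ * g) ≡ B g
    B-τ g = begin
      B (τ * g)                                   ≡⟨ B≡ (τ * g) ⟩
      ∑ {N} (λ i → A s (τ ^ toℕ i * (τ * g)))     ≡⟨ ∑-cong {N} (λ i → cong (A s) (trans (x∙yz≈y∙xz (τ ^ toℕ i) τ g) (sym (*-assoc τ (τ ^ toℕ i) g)))) ⟩
      ∑ {N} (λ i → A s (τ ^ suc (toℕ i) * g))     ≡⟨ ∑-cyclic N (λ i → A s (τ ^ i * g)) wrap ⟩
      ∑ {N} (λ i → A s (τ ^ toℕ i * g))           ≡⟨ B≡ g ⟨
      B g                                         ∎
      where
      wrap : A s (τ ^ N * g) ≡ A s (τ ^ 0 * g)
      wrap = trans (cong (λ t → A s (t * g)) τ^N≡-1) (trans (A-^m≡-1 {s} s-skew ([-1]^odd m-odd) g) (cong (A s) (sym (*-identityˡ g))))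

    B-τ^ : ∀ j g → B (τ ^ j * g) ≡ B g
    B-τ^ zero g = cong B (*-identityˡ g)
    B-τ^ (suc j) g = trans (cong B (*-assoc τ (τ ^ j) g)) (trans (B-τ (τ ^ j * g)) (B-τ^ j g))

    -- Descent on the 2-part of the order of l. If l^(m 2^(i-1)) is -1 instead of 1, a power of τ
    -- corrects the sign, and `B` is invariant under τ. The case i = u + 2 covers all of L.
    B-coset : ∀ i → i ≤ 2 ℕ.+ u → ∀ {l} → l ^ (m ℕ.* 2 ℕ.^ i) ≡ 1# → ∀ g → B (l * g) ≡ B g
    B-coset zero _ {l} eq g = trans (B≡ (l * g)) (trans (∑-cong {N} (λ i →
      trans (cong (A s) (x∙yz≈y∙xz (τ ^ toℕ i) l g)) (A-^m≡1 {s} s-skew (trans (cong (l ^_) (sym (ℕ.*-identityʳ m))) eq) (τ ^ toℕ i * g)))) (sym (B≡ g)))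
    B-coset (suc i) (s≤s i≤1+u) {l} eq g = step (square-roots-of-1 (trans (sym (^2* l e)) (trans (cong (l ^_) (sym (alg₂ m (2 ℕ.^ i)))) eq)))
      where
      e = m ℕ.* 2 ℕ.^ i
      -- Chosen so that j 2^i = N, whence t^e = (τ^N)^m = -1.
      j = 2 ℕ.^ (suc u ℕ.∸ i)
      t = τ ^ j
      alg : ∀ a b c → a ℕ.* (b ℕ.* c) ≡ a ℕ.* c ℕ.* b
      alg = ℕ-Solver.solve-∀
      alg₂ : ∀ a b → a ℕ.* (2 ℕ.* b) ≡ 2 ℕ.* (a ℕ.* b)
      alg₂ = ℕ-Solver.solve-∀
      t^e≡-1 : t ^ e ≡ - 1#
      t^e≡-1 = begin
        (τ ^ j) ^ e                       ≡⟨ ^-assocʳ τ j e ⟩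
        τ ^ (j ℕ.* e)                     ≡⟨ cong (τ ^_) (alg j m (2 ℕ.^ i)) ⟩
        τ ^ (j ℕ.* 2 ℕ.^ i ℕ.* m)         ≡⟨ cong (λ k → τ ^ (k ℕ.* m)) (trans (sym (ℕ.^-distribˡ-+-* 2 (suc u ℕ.∸ i) i)) (cong (2 ℕ.^_) (ℕ.m∸n+n≡m i≤1+u))) ⟩
        τ ^ (N ℕ.* m)                     ≡⟨ ^-assocʳ τ N m ⟨
        (τ ^ N) ^ m                       ≡⟨ cong (_^ m) τ^N≡-1 ⟩
        (- 1#) ^ m                        ≡⟨ [-1]^odd m-odd ⟩
        - 1#                              ∎
      step : l ^ e ≡ 1# ⊎ l ^ e ≡ - 1# → B (l * g) ≡ B g
      step (inj₁ l^e≡1) = B-coset i (ℕ.m≤n⇒m≤1+n i≤1+u) l^e≡1 g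
      step (inj₂ l^e≡-1) = begin
        B (l * g)              ≡⟨ B-τ^ j (l * g) ⟨
        B (t * (l * g))        ≡⟨ cong B (*-assoc t l g) ⟨
        B ((t * l) * g)        ≡⟨ B-coset i (ℕ.m≤n⇒m≤1+n i≤1+u) {t * l} (trans (^-distrib-* t l e) (trans (cong₂ _*_ t^e≡-1 l^e≡-1) [-1]²≡1)) g ⟩
        B g                    ∎

    B-κ : ∀ {l} → κ l ≡ 1# → ∀ g → B (l * g) ≡ B g
    B-κ {l} κl≡1 = B-coset (2 ℕ.+ u) ℕ.≤-refl {l} κl≡1

    -- The hyperplane transform of `B` is constant

    Φ : X → ℤ
    Φ b = S B b 0#

    -- Write b′ = bl with l in L and substitute lg for g; `B` is invariant under l.
    Φ-κ : ∀ {b b′} → b ≢ 0# → b′ ≢ 0# → κ b ≡ κ b′ → Φ b ≡ Φ b′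
    Φ-κ {b} {b′} b≢0 b′≢0 κb≡κb′ with invertible b b≢0
    ... | c , bc≡1 = trans (∑-scale (λ g → δ (T (b * g)) 0# ℤ.* B g) l≢0)
      (∑-cong (λ g → cong₂ (λ x y → δ (T x) 0# ℤ.* y) (trans (sym (*-assoc b l g)) (cong (_* g) bl≡b′)) (B-κ κl≡1 g)))
      where
      l = c * b′
      l≢0 : l ≢ 0#
      l≢0 = *-≢0 (factor≢0ʳ bc≡1) b′≢0
      bl≡b′ : b * l ≡ b′
      bl≡b′ = trans (sym (*-assoc b c b′)) (trans (cong (_* b′) bc≡1) (*-identityˡ b′))
      κl≡1 : κ l ≡ 1#
      κl≡1 = *-cancelˡ-≢0 (κ-≢0 b≢0)
        (trans (sym (κ-* b l)) (trans (cong κ bl≡b′) (trans (sym κb≡κb′) (sym (*-identityʳ (κ b))))))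

    ∣L∣>0 : 0ℤ ℤ.< ∣L∣
    ∣L∣>0 = ∑-positive (λ x → δ (κ x) 1#) (λ x → δ-nonneg (κ x) 1#) 1#
      (subst (0ℤ ℤ.<_) (sym (δ-yes κ1≡1)) (ℤ.+<+ (s≤s z≤n)))

    -- By `Φ-κ` the left side is the sum of `Φ` over the coset b₀L. It splits into the contributions
    -- of the `sᵢ`, each given by `E-coset-sum`. The result does not involve b.
    ∣L∣*Φ : ∀ {b} → b ≢ 0# → ∣L∣ ℤ.* Φ b ≡ ∑ {N} (λ i → ∣kerTᶜ∣ ℤ.* ∣L∣)
    ∣L∣*Φ {b₀} b₀≢0 = begin
      ∣L∣ ℤ.* Φ b₀                                                     ≡⟨ cong (ℤ._* Φ b₀) coset-size ⟨
      ∑ (λ b → δ (κ b) (κ b₀)) ℤ.* Φ b₀                              ≡⟨ *-distribʳ-sum (Φ b₀) (λ b → δ (κ b) (κ b₀)) ⟩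
      ∑ (λ b → δ (κ b) (κ b₀) ℤ.* Φ b₀)                              ≡⟨ ∑-cong on-coset ⟩
      ∑ (λ b → δ (κ b) (κ b₀) ℤ.* Φ b)                               ≡⟨ ∑-cong (λ b → trans (cong (δ (κ b) (κ b₀) ℤ.*_) (S-B b)) (*-distribˡ-sum {N} (δ (κ b) (κ b₀)) (λ i → E (sᵢ (toℕ i)) b))) ⟩
      ∑ (λ b → ∑ {N} λ i → δ (κ b) (κ b₀) ℤ.* E (sᵢ (toℕ i)) b)      ≡⟨ ∑-swap {v} {N} (λ b i → δ (κ b) (κ b₀) ℤ.* E (sᵢ (toℕ i)) b) ⟩
      ∑ {N} (λ i → ∑ λ b → δ (κ b) (κ b₀) ℤ.* E (sᵢ (toℕ i)) b)      ≡⟨ ∑-cong {N} (λ i → Localised.E-coset-sum {sᵢ (toℕ i)} (sᵢ-skew (toℕ i)) (sᵢ-unit (toℕ i)) b₀≢0) ⟩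
      ∑ {N} (λ i → ∣kerTᶜ∣ ℤ.* ∣L∣)                                          ∎
      where
      coset-size : ∑ (λ b → δ (κ b) (κ b₀)) ≡ ∣L∣
      coset-size = trans (∑-scale (λ b → δ (κ b) (κ b₀)) b₀≢0) (∑-cong (λ x → δ-⇔
        (λ eq → *-cancelˡ-≢0 (κ-≢0 b₀≢0) (trans (sym (κ-* b₀ x)) (trans eq (sym (*-identityʳ (κ b₀))))))
        (λ eq → trans (κ-* b₀ x) (trans (cong (κ b₀ *_) eq) (*-identityʳ (κ b₀))))))
      on-coset : ∀ b → δ (κ b) (κ b₀) ℤ.* Φ b₀ ≡ δ (κ b) (κ b₀) ℤ.* Φ b
      on-coset b with κ b Fin.≟ κ b₀
      ... | no _ = refl
      ... | yes eq = cong (1ℤ ℤ.*_) (Φ-κ b₀≢0 (λ { refl → κ-≢0 b₀≢0 (trans (sym eq) κ0≡0) }) (sym eq))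

    Φ-const : ∀ {b} → b ≢ 0# → Φ b ≡ Φ 1#
    Φ-const b≢0 = cancelˡ-pos ∣L∣>0 (trans (∣L∣*Φ b≢0) (sym (∣L∣*Φ 1≢0)))

    -- Inversion of the hyperplane transform

    ∣K*∣ : ℤ
    ∣K*∣ = ∑ λ k → δ (k ^ q) k ℤ.- δ 0# k

    -- Its value is `∣K*∣` at 0 and -1 elsewhere: as the levels over K* are equally heavy and all
    -- levels together weigh 0, `∣K*∣` times the level k in K is ψ(k) Φ(b).
    ψ : X → ℤ
    ψ k = ∣K*∣ ℤ.* δ 0# k ℤ.- (1ℤ ℤ.- δ 0# k)

    -- K*-invariance of B makes all levels k ∈ K* of T equally heavy, and the levels outside K are empty.
    S-level : ∀ b k → S B b k ≡ δ 0# k ℤ.* Φ b ℤ.+ (δ (k ^ q) k ℤ.- δ 0# k) ℤ.* S B b 1#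
    S-level b k with 0# Fin.≟ k
    ... | yes refl = trans (alg (Φ b) (S B b 1#)) (cong (λ d → 1ℤ ℤ.* Φ b ℤ.+ (d ℤ.- 1ℤ) ℤ.* S B b 1#) (sym (δ-yes 0^q≡0)))
      where
      alg : ∀ x y → x ≡ 1ℤ ℤ.* x ℤ.+ (1ℤ ℤ.- 1ℤ) ℤ.* y
      alg = ℤ-Solver.solve-∀
    ... | no 0≢k with k ^ q Fin.≟ k
    ...   | no k∉K = ∑-≡0 (λ x → cong (ℤ._* B x) (δ-no (λ eq → k∉K (trans (cong (_^ q) (sym eq)) (trans (T^q≡T (b * x)) eq)))))
    ...   | yes k∈K = trans (∑-scale (λ x → δ (T (b * x)) k ℤ.* B x) (0≢k ∘ sym)) (trans (∑-cong (λ x →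
              cong₂ ℤ._*_ (δ-⇔ (λ eq → *-cancelˡ-≢0 (0≢k ∘ sym) (trans (sym (pull x)) (trans eq (sym (*-identityʳ k)))))
                               (λ eq → trans (pull x) (trans (cong (k *_) eq) (*-identityʳ k))))
                          (B-κ (κ-K (0≢k ∘ sym) k∈K) x))) (alg (Φ b) (S B b 1#)))
      where
      alg : ∀ x y → y ≡ 0ℤ ℤ.* x ℤ.+ (1ℤ ℤ.- 0ℤ) ℤ.* y
      alg = ℤ-Solver.solve-∀
      pull : ∀ x → T (b * (k * x)) ≡ k * T (b * x)
      pull x = trans (cong T (x∙yz≈y∙xz b k x)) (T-* k∈K (b * x))

    ∑-levels : ∀ b → Φ b ℤ.+ ∣K*∣ ℤ.* S B b 1# ≡ 0ℤ
    ∑-levels b = begin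
      Φ b ℤ.+ ∣K*∣ ℤ.* S₁                                                     ≡⟨ cong₂ ℤ._+_ (∑-δ 0# (λ _ → Φ b)) (sym (*-distribʳ-sum S₁ (λ k → δ (k ^ q) k ℤ.- δ 0# k))) ⟨
      ∑ (λ k → δ 0# k ℤ.* Φ b) ℤ.+ ∑ (λ k → (δ (k ^ q) k ℤ.- δ 0# k) ℤ.* S₁)   ≡⟨ ∑-+ (λ k → δ 0# k ℤ.* Φ b) (λ k → (δ (k ^ q) k ℤ.- δ 0# k) ℤ.* S₁) ⟨
      ∑ (λ k → δ 0# k ℤ.* Φ b ℤ.+ (δ (k ^ q) k ℤ.- δ 0# k) ℤ.* S₁)          ≡⟨ ∑-cong (S-level b) ⟨
      ∑ (λ k → S B b k)                                                    ≡⟨ ∑-swap (λ k x → δ (T (b * x)) k ℤ.* B x) ⟩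
      ∑ (λ x → ∑ λ k → δ (T (b * x)) k ℤ.* B x)                            ≡⟨ ∑-cong (λ x → ∑-δ (T (b * x)) (λ _ → B x)) ⟩
      ∑ B                                                                  ≡⟨ ∑B≡0 ⟩
      0ℤ                                                                   ∎
      where
      S₁ = S B b 1#

    Φ≡ : ∀ b → Φ b ≡ (1ℤ ℤ.- δ 0# b) ℤ.* Φ 1#
    Φ≡ b with 0# Fin.≟ b
    ... | yes refl = trans (∑-cong (λ x → trans (cong (ℤ._* B x) (δ-yes (trans (cong T (zeroˡ x)) T0≡0))) (ℤ.*-identityˡ (B x)))) ∑B≡0
    ... | no 0≢b = trans (Φ-const (0≢b ∘ sym)) (sym (ℤ.*-identityˡ (Φ 1#)))

    -- `∑-levels` eliminates the weight of the levels over K*, and `Φ≡` reduces `Φ b` to a single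
    -- constant. Multiplying by `∣K*∣` avoids a division.
    S-scaled : ∀ b g → ∣K*∣ ℤ.* S B b (T (b * g)) ≡ ψ (T (b * g)) ℤ.* ((1ℤ ℤ.- δ 0# b) ℤ.* Φ 1#)
    S-scaled b g = begin
      ∣K*∣ ℤ.* S B b k                                                       ≡⟨ cong (∣K*∣ ℤ.*_) (S-level b k) ⟩
      ∣K*∣ ℤ.* (D ℤ.* Φ b ℤ.+ (δ (k ^ q) k ℤ.- D) ℤ.* S₁)                    ≡⟨ cong (λ d → ∣K*∣ ℤ.* (D ℤ.* Φ b ℤ.+ (d ℤ.- D) ℤ.* S₁)) (δ-yes (T^q≡T (b * g))) ⟩
      ∣K*∣ ℤ.* (D ℤ.* Φ b ℤ.+ (1ℤ ℤ.- D) ℤ.* S₁)                             ≡⟨ alg ∣K*∣ D (Φ b) S₁ ⟩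
      ψ k ℤ.* Φ b ℤ.+ (1ℤ ℤ.- D) ℤ.* (Φ b ℤ.+ ∣K*∣ ℤ.* S₁)                   ≡⟨ cong (λ w → ψ k ℤ.* Φ b ℤ.+ (1ℤ ℤ.- D) ℤ.* w) (∑-levels b) ⟩
      ψ k ℤ.* Φ b ℤ.+ (1ℤ ℤ.- D) ℤ.* 0ℤ                                   ≡⟨ alg₀ (ψ k ℤ.* Φ b) (1ℤ ℤ.- D) ⟩
      ψ k ℤ.* Φ b                                                         ≡⟨ cong (ψ k ℤ.*_) (Φ≡ b) ⟩
      ψ k ℤ.* ((1ℤ ℤ.- δ 0# b) ℤ.* Φ 1#)                                  ∎
      where
      k = T (b * g)
      D = δ 0# k
      S₁ = S B b 1#
      alg : ∀ c d x y → c ℤ.* (d ℤ.* x ℤ.+ (1ℤ ℤ.- d) ℤ.* y) ≡ (c ℤ.* d ℤ.- (1ℤ ℤ.- d)) ℤ.* x ℤ.+ (1ℤ ℤ.- d) ℤ.* (x ℤ.+ c ℤ.* y)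
      alg = ℤ-Solver.solve-∀
      alg₀ : ∀ x y → x ℤ.+ y ℤ.* 0ℤ ≡ x
      alg₀ = ℤ-Solver.solve-∀

    ∣K*∣>0 : 0ℤ ℤ.< ∣K*∣
    ∣K*∣>0 = ∑-positive (λ k → δ (k ^ q) k ℤ.- δ 0# k) nonneg 1#
      (subst (0ℤ ℤ.<_) (sym (cong₂ ℤ._-_ (δ-yes (1^ q)) (δ-no (1≢0 ∘ sym)))) (ℤ.+<+ (s≤s z≤n)))
      where
      nonneg : ∀ k → 0ℤ ℤ.≤ δ (k ^ q) k ℤ.- δ 0# k
      nonneg k with 0# Fin.≟ k
      ... | yes refl = subst (λ d → 0ℤ ℤ.≤ d ℤ.- 1ℤ) (sym (δ-yes 0^q≡0)) ℤ.≤-refl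
      ... | no _ = subst (0ℤ ℤ.≤_) (sym (ℤ.+-identityʳ (δ (k ^ q) k))) (δ-nonneg (k ^ q) k)

    ∣kerTᶜ∣>0 : 0ℤ ℤ.< ∣kerTᶜ∣
    ∣kerTᶜ∣>0 = subst (0ℤ ℤ.<_) (sym H≡) (∑-positive (λ b → 1ℤ ℤ.- δ (T b) 0#) nonneg 1#
      (subst (λ d → 0ℤ ℤ.< 1ℤ ℤ.- d) (sym (δ-no T1≢0)) (ℤ.+<+ (s≤s z≤n))))
      where
      H≡ : ∣kerTᶜ∣ ≡ ∑ (λ b → 1ℤ ℤ.- δ (T b) 0#)
      H≡ = trans (cong (λ w → ∑ (λ (b : X) → 1ℤ) ℤ.+ w) (sym (∑-neg (λ b → δ (T b) 0#)))) (sym (∑-+ (λ (b : X) → 1ℤ) (λ b → ℤ.- δ (T b) 0#)))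
      nonneg : ∀ b → 0ℤ ℤ.≤ 1ℤ ℤ.- δ (T b) 0#
      nonneg b with does (T b Fin.≟ 0#)
      ... | true = ℤ.≤-refl
      ... | false = ℤ.+≤+ z≤n

    -- Translating by g moves the value B(g) to the origin, where `radon` recovers it from the
    -- levels T(bg). These are known from `S-scaled`, and the substitution y = gb then removes g.
    B-scaled : ∀ {g} → g ≢ 0# → ∣K*∣ ℤ.* (∣kerTᶜ∣ ℤ.* B g) ≡ ∑ (λ y → ψ (T y) ℤ.* ((1ℤ ℤ.- δ 0# y) ℤ.* Φ 1#))
    B-scaled {g} g≢0 = begin
      ∣K*∣ ℤ.* (∣kerTᶜ∣ ℤ.* B g)                                                  ≡⟨ cong (λ w → ∣K*∣ ℤ.* (∣kerTᶜ∣ ℤ.* B w)) (+-identityˡ g) ⟨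
      ∣K*∣ ℤ.* (∣kerTᶜ∣ ℤ.* B (0# + g))                                           ≡⟨ cong (∣K*∣ ℤ.*_) (radon (trans (sym (∑-translate B g)) ∑B≡0)) ⟨
      ∣K*∣ ℤ.* ∑ (λ b → S (λ x → B (x + g)) b 0#)                           ≡⟨ cong (∣K*∣ ℤ.*_) (∑-cong (λ b → shift-level B b g)) ⟩
      ∣K*∣ ℤ.* ∑ (λ b → S B b (T (b * g)))                                  ≡⟨ *-distribˡ-sum ∣K*∣ (λ b → S B b (T (b * g))) ⟩
      ∑ (λ b → ∣K*∣ ℤ.* S B b (T (b * g)))                                  ≡⟨ ∑-cong (λ b → S-scaled b g) ⟩
      ∑ (λ b → ψ (T (b * g)) ℤ.* ((1ℤ ℤ.- δ 0# b) ℤ.* Φ 1#))             ≡⟨ ∑-cong (λ b → cong₂ (λ x y → ψ (T x) ℤ.* ((1ℤ ℤ.- y) ℤ.* Φ 1#)) (*-comm b g) (δ-g b)) ⟩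
      ∑ (λ b → ψ (T (g * b)) ℤ.* ((1ℤ ℤ.- δ 0# (g * b)) ℤ.* Φ 1#))       ≡⟨ ∑-scale (λ y → ψ (T y) ℤ.* ((1ℤ ℤ.- δ 0# y) ℤ.* Φ 1#)) g≢0 ⟨
      ∑ (λ y → ψ (T y) ℤ.* ((1ℤ ℤ.- δ 0# y) ℤ.* Φ 1#))                   ∎
      where
      δ-g : ∀ b → δ 0# b ≡ δ 0# (g * b)
      δ-g b = δ-⇔ (λ eq → sym (trans (cong (g *_) (sym eq)) (zeroʳ g))) (λ eq → sym (xy≡0⇒y≡0 g≢0 (sym eq)))

    B-const : ∀ {g} → g ≢ 0# → B g ≡ B 1#
    B-const g≢0 = cancelˡ-pos ∣kerTᶜ∣>0 (cancelˡ-pos ∣K*∣>0 (trans (B-scaled g≢0) (sym (B-scaled 1≢0))))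

    -- Counting pairs with a given difference

    side : X → Bool
    side x = does ((x ^ m) Fin.<? (- (x ^ m)))

    nz : X → ℤ
    nz x = 1ℤ ℤ.- δ 0# x

    s² : ∀ x → s x ℤ.* s x ≡ nz x
    s² x with 0# Fin.≟ x
    ... | yes refl = cong (λ w → w ℤ.* w) (skew-0 {s} s-skew)
    ... | no 0≢x = s-unit (0≢x ∘ sym)

    2*side : ∀ x → ind (side x) ℤ.+ ind (side x) ≡ nz x ℤ.+ s x
    2*side x = trans (cases (Fin.<-cmp (x ^ m) (- (x ^ m)))) (cong (ℤ._+ s x) (s² x))
      where
      cases : Tri ((x ^ m) Fin.< (- (x ^ m))) ((x ^ m) ≡ (- (x ^ m))) ((- (x ^ m)) Fin.< (x ^ m)) →
              ind (side x) ℤ.+ ind (side x) ≡ s x ℤ.* s x ℤ.+ s x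
      cases (tri< < _ ≯) = trans (cong (λ d → d ℤ.+ d) (lt-yes <)) (cong₂ (λ a b → (a ℤ.- b) ℤ.* (a ℤ.- b) ℤ.+ (a ℤ.- b)) (sym (lt-yes <)) (sym (lt-no ≯)))
      cases (tri≈ ≮ _ ≯) = trans (cong (λ d → d ℤ.+ d) (lt-no ≮)) (cong₂ (λ a b → (a ℤ.- b) ℤ.* (a ℤ.- b) ℤ.+ (a ℤ.- b)) (sym (lt-no ≮)) (sym (lt-no ≯)))
      cases (tri> ≮ _ >) = trans (cong (λ d → d ℤ.+ d) (lt-no ≮)) (cong₂ (λ a b → (a ℤ.- b) ℤ.* (a ℤ.- b) ℤ.+ (a ℤ.- b)) (sym (lt-no ≮)) (sym (lt-yes >)))

    -- The number of x with x and x + g both nonzero, taken at g = 1; scaling shows that it is the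
    -- same for every g ≠ 0.
    M : ℤ
    M = ∑ λ x → nz (x + 1#) ℤ.* nz x

    -- The number of representations of g as a difference within the i-th block.
    pairs : ℕ → X → ℤ
    pairs i g = ∑ λ x → ind (side (τ ^ i * (x + g))) ℤ.* ind (side (τ ^ i * x))

    nz-scale : ∀ {a} → a ≢ 0# → ∀ x → nz (a * x) ≡ nz x
    nz-scale {a} a≢0 x = cong (λ w → 1ℤ ℤ.- w) (δ-⇔ (λ eq → sym (xy≡0⇒y≡0 a≢0 (sym eq))) (λ eq → sym (trans (cong (a *_) (sym eq)) (zeroʳ a))))

    -- Writing 2·1_D = s² + s, the cross terms contribute s(g) and − s(g), which cancel.
    4*pairs : ∀ i {g} → g ≢ 0# → ℤ.+ 4 ℤ.* pairs i g ≡ M ℤ.+ A (sᵢ i) g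
    4*pairs i {g} g≢0 = begin
      ℤ.+ 4 ℤ.* pairs i g                       ≡⟨ *-distribˡ-sum (ℤ.+ 4) (λ x → d (x + g) ℤ.* d x) ⟩
      ∑ (λ x → ℤ.+ 4 ℤ.* (d (x + g) ℤ.* d x))   ≡⟨ ∑-cong (λ x → trans (alg (d (x + g)) (d x)) (trans (cong₂ ℤ._*_ (2d (x + g)) (2d x)) (expand (δ 0# (x + g)) (f (x + g)) (δ 0# x) (f x)))) ⟩
      ∑ (λ x → (nz (x + g) ℤ.* nz x ℤ.+ f (x + g) ℤ.* f x) ℤ.+ ((f x ℤ.- δ 0# (x + g) ℤ.* f x) ℤ.+ (f (x + g) ℤ.- δ 0# x ℤ.* f (x + g))))
        ≡⟨ ∑-+ (λ x → nz (x + g) ℤ.* nz x ℤ.+ f (x + g) ℤ.* f x) (λ x → (f x ℤ.- δ 0# (x + g) ℤ.* f x) ℤ.+ (f (x + g) ℤ.- δ 0# x ℤ.* f (x + g))) ⟩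
      ∑ (λ x → nz (x + g) ℤ.* nz x ℤ.+ f (x + g) ℤ.* f x) ℤ.+ ∑ (λ x → (f x ℤ.- δ 0# (x + g) ℤ.* f x) ℤ.+ (f (x + g) ℤ.- δ 0# x ℤ.* f (x + g)))
        ≡⟨ cong₂ ℤ._+_ (trans (∑-+ (λ x → nz (x + g) ℤ.* nz x) (λ x → f (x + g) ℤ.* f x)) (cong (ℤ._+ A f g) nz-pairs)) cross ⟩
      M ℤ.+ A f g ℤ.+ 0ℤ                        ≡⟨ ℤ.+-identityʳ (M ℤ.+ A f g) ⟩
      M ℤ.+ A f g                               ∎
      where
      f d : X → ℤ
      f = sᵢ i
      d x = ind (side (τ ^ i * x))
      f-skew : Skew f
      f-skew = sᵢ-skew i
      2d : ∀ x → d x ℤ.+ d x ≡ nz x ℤ.+ f x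
      2d x = trans (2*side (τ ^ i * x)) (cong (ℤ._+ f x) (nz-scale (^-≢0 i τ≢0) x))
      alg : ∀ a b → ℤ.+ 4 ℤ.* (a ℤ.* b) ≡ (a ℤ.+ a) ℤ.* (b ℤ.+ b)
      alg = ℤ-Solver.solve-∀
      expand : ∀ a b c d → ((1ℤ ℤ.- a) ℤ.+ b) ℤ.* ((1ℤ ℤ.- c) ℤ.+ d) ≡ ((1ℤ ℤ.- a) ℤ.* (1ℤ ℤ.- c) ℤ.+ b ℤ.* d) ℤ.+ ((d ℤ.- a ℤ.* d) ℤ.+ (b ℤ.- c ℤ.* b))
      expand = ℤ-Solver.solve-∀
      nz-pairs : ∑ (λ x → nz (x + g) ℤ.* nz x) ≡ M
      nz-pairs = trans (∑-scale (λ x → nz (x + g) ℤ.* nz x) g≢0) (∑-cong (λ x → cong₂ ℤ._*_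
        (trans (cong nz (trans (cong (g * x +_) (sym (*-identityʳ g))) (sym (distribˡ g x 1#)))) (nz-scale g≢0 (x + 1#)))
        (nz-scale g≢0 x)))
      ∑-minus : (a b : X → ℤ) → ∑ (λ x → a x ℤ.- b x) ≡ ∑ a ℤ.- ∑ b
      ∑-minus a b = trans (∑-+ a (λ x → ℤ.- b x)) (cong (λ w → ∑ a ℤ.+ w) (∑-neg b))
      cross₁ : ∑ (λ x → f x ℤ.- δ 0# (x + g) ℤ.* f x) ≡ f g
      cross₁ = begin
        ∑ (λ x → f x ℤ.- δ 0# (x + g) ℤ.* f x)           ≡⟨ ∑-minus f (λ x → δ 0# (x + g) ℤ.* f x) ⟩
        ∑ f ℤ.- ∑ (λ x → δ 0# (x + g) ℤ.* f x)           ≡⟨ cong₂ ℤ._-_ (∑-skew f-skew) (trans (∑-cong (λ x → cong (ℤ._* f x) (δ-shift x))) (∑-δ (- 1# * g) f)) ⟩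
        0ℤ ℤ.- f (- 1# * g)                              ≡⟨ cong (λ w → 0ℤ ℤ.- w) (skew-neg f-skew g) ⟩
        0ℤ ℤ.- ℤ.- f g                                   ≡⟨ neg-neg (f g) ⟩
        f g                                              ∎
        where
        neg-neg : ∀ a → 0ℤ ℤ.- ℤ.- a ≡ a
        neg-neg = ℤ-Solver.solve-∀
        δ-shift : ∀ x → δ 0# (x + g) ≡ δ (- 1# * g) x
        δ-shift x = δ-⇔
          (λ eq → trans (-1*x≈-x g) (sym (negative-unique g x (trans (+-comm g x) (sym eq)))))
          (λ eq → trans (sym (-‿inverseˡ g)) (cong (_+ g) (trans (sym (-1*x≈-x g)) eq)))
      cross₂ : ∑ (λ x → f (x + g) ℤ.- δ 0# x ℤ.* f (x + g)) ≡ ℤ.- f g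
      cross₂ = begin
        ∑ (λ x → f (x + g) ℤ.- δ 0# x ℤ.* f (x + g))              ≡⟨ ∑-minus (λ x → f (x + g)) (λ x → δ 0# x ℤ.* f (x + g)) ⟩
        ∑ (λ x → f (x + g)) ℤ.- ∑ (λ x → δ 0# x ℤ.* f (x + g))    ≡⟨ cong₂ ℤ._-_ (trans (sym (∑-translate f g)) (∑-skew f-skew)) (trans (∑-δ 0# (λ x → f (x + g))) (cong f (+-identityˡ g))) ⟩
        0ℤ ℤ.- f g                                                ≡⟨ ℤ.+-identityˡ (ℤ.- f g) ⟩
        ℤ.- f g                                                   ∎
      cross : ∑ (λ x → (f x ℤ.- δ 0# (x + g) ℤ.* f x) ℤ.+ (f (x + g) ℤ.- δ 0# x ℤ.* f (x + g))) ≡ 0ℤ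
      cross = trans (∑-+ (λ x → f x ℤ.- δ 0# (x + g) ℤ.* f x) (λ x → f (x + g) ℤ.- δ 0# x ℤ.* f (x + g)))
        (trans (cong₂ ℤ._+_ cross₁ cross₂) (ℤ.+-inverseʳ (f g)))

    -- Summing `4*pairs` over the blocks gives N M + B(g), which is constant by `B-const`.
    ∑-pairs : ∀ {g} → g ≢ 0# → ∑ {N} (λ i → pairs (toℕ i) g) ≡ ∑ {N} (λ i → pairs (toℕ i) 1#)
    ∑-pairs g≢0 = cancelˡ-pos {ℤ.+ 4} (ℤ.+<+ (s≤s z≤n)) (trans (total g≢0) (trans (cong (λ w → ∑ {N} (λ _ → M) ℤ.+ w) (B-const g≢0)) (sym (total 1≢0))))
      where
      total : ∀ {g} → g ≢ 0# → ℤ.+ 4 ℤ.* ∑ {N} (λ i → pairs (toℕ i) g) ≡ ∑ {N} (λ _ → M) ℤ.+ B g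
      total {g} g≢0 = begin
        ℤ.+ 4 ℤ.* ∑ {N} (λ i → pairs (toℕ i) g)            ≡⟨ *-distribˡ-sum {N} (ℤ.+ 4) (λ i → pairs (toℕ i) g) ⟩
        ∑ {N} (λ i → ℤ.+ 4 ℤ.* pairs (toℕ i) g)            ≡⟨ ∑-cong {N} (λ i → 4*pairs (toℕ i) g≢0) ⟩
        ∑ {N} (λ i → M ℤ.+ A (sᵢ (toℕ i)) g)               ≡⟨ ∑-+ {N} (λ _ → M) (λ i → A (sᵢ (toℕ i)) g) ⟩
        ∑ {N} (λ _ → M) ℤ.+ ∑ {N} (λ i → A (sᵢ (toℕ i)) g) ≡⟨ cong (λ w → ∑ {N} (λ _ → M) ℤ.+ w) (B-def g) ⟨
        ∑ {N} (λ _ → M) ℤ.+ B g                            ∎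

    -- The blocks and their differences

    block : Fin N → Subset v
    block i = tabulate (λ x → side (τ ^ toℕ i * x))

    -- The blocks are dilates of one set by powers of τ⁻¹.
    ∣block∣ : ∀ i → ∣ block i ∣ ≡ ∣ tabulate side ∣
    ∣block∣ i = ℤ.+-injective (begin
      ℤ.+ ∣ block i ∣                                  ≡⟨ +∣tabulate∣ (λ x → side (τ ^ toℕ i * x)) ⟩
      ∑ (λ x → ind (side (τ ^ toℕ i * x)))             ≡⟨ ∑-scale (λ x → ind (side x)) (^-≢0 (toℕ i) τ≢0) ⟨
      ∑ (λ x → ind (side x))                           ≡⟨ +∣tabulate∣ side ⟨
      ℤ.+ ∣ tabulate side ∣                            ∎)

    -- The counterpart of `diffCount` for the field structure on `Fin v`.
    differences : X → ℕ
    differences g = sumF λ i → sumF λ a → sumF λ b →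
      indicator (isYes (a ∈? block i) ∧ isYes (b ∈? block i) ∧ not (isYes (a Fin.≟ b)) ∧ does (a - b Fin.≟ g))

    -- The equation a - b = g with g ≠ 0 already forces a and b to be distinct, and it leaves a = b
    -- + g as the only term of the sum over a.
    +differences : ∀ {g} → g ≢ 0# → ℤ.+ differences g ≡ ∑ {N} (λ i → pairs (toℕ i) g)
    +differences {g} g≢0 = trans (+sumF {N} _) (∑-cong {N} (λ i → trans (+sumF {v} _) (trans (∑-cong (λ a → trans (+sumF {v} _) (∑-cong (term i a))))
      (trans (∑-swap (λ a b → δ (b + g) a ℤ.* (d i a ℤ.* d i b))) (∑-cong (λ b → ∑-δ (b + g) (λ a → d i a ℤ.* d i b)))))))
      where
      d : Fin N → X → ℤ
      d i x = ind (side (τ ^ toℕ i * x))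
      alg : ∀ a b c → a ℤ.* (b ℤ.* c) ≡ c ℤ.* (a ℤ.* b)
      alg = ℤ-Solver.solve-∀
      distinct : ∀ a b → not (isYes (a Fin.≟ b)) ∧ does (a - b Fin.≟ g) ≡ does ((b + g) Fin.≟ a)
      distinct a b with (b + g) Fin.≟ a
      ... | yes b+g≡a = cong₂ (λ x y → not x ∧ y)
              (trans (isYes≗does (a Fin.≟ b)) (dec-false (a Fin.≟ b) (λ a≡b → g≢0 (+-cancelˡ b g 0# (trans b+g≡a (trans a≡b (sym (+-identityʳ b))))))))
              (dec-true (a - b Fin.≟ g) (trans (cong (_- b) (trans (sym b+g≡a) (+-comm b g))) (x+y-y≡x g b)))
      ... | no b+g≢a = trans (cong (not (isYes (a Fin.≟ b)) ∧_) (dec-false (a - b Fin.≟ g)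
              (λ eq → b+g≢a (trans (cong (b +_) (sym eq)) (y+[x-y]≡x a b))))) (∧-zeroʳ _)
      term : ∀ i a b → ℤ.+ indicator (isYes (a ∈? block i) ∧ isYes (b ∈? block i) ∧ not (isYes (a Fin.≟ b)) ∧ does (a - b Fin.≟ g))
           ≡ δ (b + g) a ℤ.* (d i a ℤ.* d i b)
      term i a b = begin
        ℤ.+ indicator (isYes (a ∈? block i) ∧ isYes (b ∈? block i) ∧ not (isYes (a Fin.≟ b)) ∧ does (a - b Fin.≟ g))
          ≡⟨ +indicator _ ⟩
        ind (isYes (a ∈? block i) ∧ isYes (b ∈? block i) ∧ not (isYes (a Fin.≟ b)) ∧ does (a - b Fin.≟ g))
          ≡⟨ cong₂ (λ x y → ind (x ∧ y)) (isYes-∈?-tabulate side-i a) (cong₂ _∧_ (isYes-∈?-tabulate side-i b) (distinct a b)) ⟩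
        ind (side-i a ∧ side-i b ∧ does ((b + g) Fin.≟ a))
          ≡⟨ trans (ind-∧ (side-i a) _) (cong (d i a ℤ.*_) (ind-∧ (side-i b) _)) ⟩
        d i a ℤ.* (d i b ℤ.* δ (b + g) a)
          ≡⟨ alg (d i a) (d i b) (δ (b + g) a) ⟩
        δ (b + g) a ℤ.* (d i a ℤ.* d i b) ∎
        where
        side-i : X → Bool
        side-i x = side (τ ^ toℕ i * x)

    differences-const : ∀ {g} → g ≢ 0# → differences g ≡ differences 1#
    differences-const g≢0 = ℤ.+-injective (trans (+differences g≢0) (trans (∑-pairs g≢0) (sym (+differences 1≢0))))

    -- The blocks are skew

    root : Fin N → X → X
    root i x = (τ ^ toℕ i * x) ^ m

    root-neg : ∀ i x → root i (- x) ≡ - root i x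
    root-neg i x = trans (cong (_^ m) (sym (-‿distribʳ-* (τ ^ toℕ i) x))) ([-x]^odd (τ ^ toℕ i * x) m-odd)

    side⁻ : ∀ {x} → side x ≡ true → (x ^ m) Fin.< (- (x ^ m))
    side⁻ {x} = does-true ((x ^ m) Fin.<? (- (x ^ m)))

    block⁻ : ∀ i {x} → x ∈ block i → root i x Fin.< (- root i x)
    block⁻ i x∈ = side⁻ (∈-tabulate⁻ (λ x → side (τ ^ toℕ i * x)) x∈)

    block⁺ : ∀ i {x} → root i x Fin.< (- root i x) → x ∈ block i
    block⁺ i {x} < = ∈-tabulate⁺ (λ x → side (τ ^ toℕ i * x)) (dec-true (root i x Fin.<? (- root i x)) <)

    block-neg⁻ : ∀ i {x} → (- x) ∈ block i → (- root i x) Fin.< root i x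
    block-neg⁻ i {x} x∈ = subst₂ Fin._<_ (root-neg i x) (trans (cong -_ (root-neg i x)) (-‿involutive _)) (block⁻ i x∈)

    block-disjoint : ∀ i x → ¬ (x ∈ block i × (- x) ∈ block i)
    block-disjoint i x (x∈ , -x∈) = Fin.<-asym (block⁻ i x∈) (block-neg⁻ i -x∈)

    -- Being its own negative, 0 would violate `block-disjoint`.
    block-≢0 : ∀ i {x} → x ∈ block i ⊎ (- x) ∈ block i → x ≢ 0#
    block-≢0 i (inj₁ x∈) refl = block-disjoint i 0# (x∈ , subst (_∈ block i) (sym -0#≈0#) x∈)
    block-≢0 i (inj₂ x∈) refl = block-disjoint i 0# (subst (_∈ block i) -0#≈0# x∈ , x∈)

    block-cover : ∀ i {x} → x ≢ 0# → x ∈ block i ⊎ (- x) ∈ block i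
    block-cover i {x} x≢0 = cases (Fin.<-cmp (root i x) (- root i x))
      where
      cases : Tri (root i x Fin.< (- root i x)) (root i x ≡ - root i x) ((- root i x) Fin.< root i x) → x ∈ block i ⊎ (- x) ∈ block i
      cases (tri< < _ _) = inj₁ (block⁺ i <)
      cases (tri≈ _ y≡-y _) = ⊥-elim (x≢-x (^-≢0 m (*-≢0 (^-≢0 (toℕ i) τ≢0) x≢0)) y≡-y)
      cases (tri> _ _ >) = inj₂ (block⁺ i (subst₂ Fin._<_ (sym (root-neg i x)) (sym (trans (cong -_ (root-neg i x)) (-‿involutive _))) >))

-- Transport along the enumeration

open import Data.Nat using (_+_; _*_; _∸_; _^_)

module Transport {c ℓ} (F : CommutativeRing c ℓ) (isField : IsField F) {v : ℕ}
  (enum : Enumeration (CommutativeRing.+-abelianGroup F) v) where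

  private
    module F = CommutativeRing F
  open Inverse enum using (to; from; to-cong; from-cong; inverseˡ; inverseʳ)
  open DF F.+-abelianGroup enum

  to∘from : ∀ x → to (from x) F.≈ x
  to∘from x = inverseˡ refl

  from∘to : ∀ a → from (to a) ≡ a
  from∘to a = inverseʳ F.refl

  rawRing : RawRing 0ℓ 0ℓ
  rawRing = record
    { Carrier = Fin v ; _≈_ = _≡_
    ; _+_ = λ a b → from (to a F.+ to b) ; _*_ = λ a b → from (to a F.* to b)
    ; -_ = λ a → from (F.- to a) ; 0# = from F.0# ; 1# = from F.1# }

  open RawRing rawRing using () renaming (_+_ to _⊕_; _*_ to _⊛_; -_ to ⊝_; 0# to 𝟘; 1# to 𝟙)

  to-isRingMonomorphism : IsRingMonomorphism rawRing F.rawRing to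
  to-isRingMonomorphism = record
    { isRingHomomorphism = record
      { isSemiringHomomorphism = record
        { isNearSemiringHomomorphism = record
          { +-isMonoidHomomorphism = record
            { isMagmaHomomorphism = record
              { isRelHomomorphism = record { cong = to-cong }
              ; homo = λ a b → to∘from _ }
            ; ε-homo = to∘from _ }
          ; *-homo = λ a b → to∘from _ }
        ; 1#-homo = to∘from _ }
      ; -‿homo = λ a → to∘from _ }
    ; injective = λ {a} {b} eq → trans (sym (from∘to a)) (trans (from-cong eq) (from∘to b)) }

  isCommutativeRing : IsCommutativeRing _≡_ _⊕_ _⊛_ ⊝_ 𝟘 𝟙
  isCommutativeRing = RingMonomorphism.isCommutativeRing to-isRingMonomorphism F.isCommutativeRing

  from-≢𝟘 : ∀ {x} → x F.≉ F.0# → from x ≢ 𝟘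
  from-≢𝟘 {x} neq eq = neq (F.trans (F.sym (to∘from x)) (F.trans (to-cong eq) (to∘from F.0#)))

  1≢0 : 𝟙 ≢ 𝟘
  1≢0 = from-≢𝟘 (proj₁ isField)

  invertible : ∀ a → a ≢ 𝟘 → ∃[ b ] a ⊛ b ≡ 𝟙
  invertible a a≢0 with proj₂ isField (to a) (λ eq → a≢0 (trans (sym (from∘to a)) (from-cong eq)))
  ... | y , ay≈1 = from y , from-cong (F.trans (F.*-congˡ (to∘from y)) ay≈1)

  isYes-≈? : ∀ x y → isYes (x ≈? y) ≡ does (from x Fin.≟ from y)
  isYes-≈? x y = trans (isYes≗does (x ≈? y)) (compare (from x Fin.≟ from y))
    where
    compare : Dec (from x ≡ from y) → does (x ≈? y) ≡ does (from x Fin.≟ from y)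
    compare (yes eq) = trans (dec-true (x ≈? y) (F.trans (F.sym (to∘from x)) (F.trans (to-cong eq) (to∘from y))))
      (sym (dec-true (from x Fin.≟ from y) eq))
    compare (no neq) = trans (dec-false (x ≈? y) (neq ∘ from-cong)) (sym (dec-false (from x Fin.≟ from y) neq))

  module _ {p u : ℕ} (p-prime : Prime p) (params : Parameters (2 + u) v p) where
    open FiniteField.Construction isCommutativeRing 1≢0 invertible {p} {u} p-prime params

    from-neg : ∀ x → from (F.- x) ≡ ⊝ from x
    from-neg x = from-cong (F.-‿cong (F.sym (to∘from x)))

    -- Blocks are subsets of the index set on both sides, so only the test of the difference against
    -- x has to be translated.
    diffCount≡differences : ∀ x → diffCount block x ≡ differences (from x)
    diffCount≡differences x = sumF-cong {2 ^ suc u} (λ i → sumF-cong (λ a → sumF-cong (λ b →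
      cong (λ y → indicator (isYes (a ∈? block i) ∧ isYes (b ∈? block i) ∧ not (isYes (a Fin.≟ b)) ∧ y))
        (trans (isYes-≈? (to a F.- to b) x) (cong (λ y → does (y Fin.≟ from x)) (from-cong (F.+-congˡ (F.sym (to∘from _)))))))))

    skewHadamardDF : SkewHadamardDF (2 ^ suc u)
    skewHadamardDF = block ,
      (_ , _ , ∣block∣ , (λ x x≉0 → trans (diffCount≡differences x) (differences-const (from-≢𝟘 x≉0)))) ,
      (λ i → (λ x (x∈ , -x∈) → block-disjoint i (from x) (x∈ , subst (_∈ block i) (from-neg x) -x∈))
           , (λ x → mk⇔
               (λ { (inj₁ x∈) → block-≢0 i (inj₁ x∈) ∘ from-cong
                  ; (inj₂ -x∈) → block-≢0 i (inj₂ (subst (_∈ block i) (from-neg x) -x∈)) ∘ from-cong })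
               (λ x≉0 → cover i x (block-cover i (from-≢𝟘 x≉0)))))
      where
      cover : ∀ i x → from x ∈ block i ⊎ (⊝ from x) ∈ block i → x ∈G block i ⊎ (F.- x) ∈G block i
      cover i x (inj₁ x∈) = inj₁ x∈
      cover i x (inj₂ -x∈) = inj₂ (subst (_∈ block i) (sym (from-neg x)) -x∈)

theorem1p5 : ∀ {c ℓ} (u : ℕ) → 2 ≤ u → (q : ℕ)
    → (∃[ p ] ∃[ m ] (Prime p × 1 ≤ m × q ≡ p ^ m))
    → (∃[ t ] (q ≡ 2 ^ u + 1 + t * 2 ^ suc u))
    → (e : ℕ) → 1 ≤ e
    → (F : CommutativeRing c ℓ) → IsField F
    → (enum : Enumeration (CommutativeRing.+-abelianGroup F) (q ^ e))
    → DF.SkewHadamardDF (CommutativeRing.+-abelianGroup F) enum (2 ^ (u ∸ 1))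
theorem1p5 (suc (suc u)) (s≤s (s≤s z≤n)) _ (p , n , p-prime , _ , refl) (t , q≡) e 1≤e F isField enum =
  -- The matched `u` is two less than the exponent of the theorem, so the number of blocks reads
  -- `2 ^ suc u`.
  Transport.skewHadamardDF F isField enum {p} {u} p-prime (parameters u p n t e 1≤e q≡)
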